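{- With $W(N,k)$ as in the context and $\Delta W(N,k)=W(N,k+1)-W(N,k)$, for all $N\ge2$ and $0\le k\le N-2$, $$\Delta W(N,k)=c_1(N,k)\left(\Big(\sum_{i=k+1}^{N-1}\frac1i\Big)\theta-1\right)\theta\,[\theta]_k,\qquad c_1(N,k)=\prod_{j=k+1}^{N-1}j .$$ Hence $\Delta W(N,k)$, as a polynomial in $\theta$, has only real roots, and its only positive root is $\theta=\big(\sum_{i=k+1}^{N-1}\frac1i\big)^{ -1}$.
   Context: $\theta$ is a variable (positive real). $\mathrm{lrm}(\pi)$ is the number of left-to-right maxima of $\pi$ (entries larger than all entries to their left). $[\theta]_k=\theta(\theta+1)\cdots(\theta+k-1)$, $[\theta]_0=1$. A permutation $\pi\in\mathfrak{S}_N$ is $k$-winnable if the strategy that rejects the first $k$ entries and then accepts the first subsequent left-to-right maximum selects the entry $N$. $W(N,k)=\sum_{k\text{ -winnable }\pi\in\mathfrak{S}_N}\theta^{\mathrm{lrm}(\pi)}$.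
   Formalization: The variable θ ranges over the rationals rather than the positive reals, in both the identity for ΔW(N,k) and its factorisation into linear factors. -}

module Defs where

open import Data.Nat as ℕ using (ℕ; zero; suc; _<ᵇ_)
import Data.Bool
open import Data.Bool using (Bool; true; false; if_then_else_)
open import Data.Fin using (Fin; toℕ)
open import Data.List as List using (List; []; _∷_; applyUpTo; allFin)
open import Data.Vec as Vec using (Vec)
open import Data.Maybe using (Maybe; just; nothing)
open import Data.Integer using (+_)
open import Data.Rational using (ℚ; 0ℚ; 1ℚ; _+_; _*_; _-_; _/_)
open import Relation.Binary.PropositionalEquality using (_≡_)
open import Relation.Nullary.Decidable using (does)
open import Data.List.Relation.Unary.Unique.Propositional using (Unique)
import Data.List.Relation.Unary.Unique.DecPropositional as UDec
import Data.Fin.Properties as FinP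

Σℚ : List ℚ → ℚ
Σℚ = List.foldr _+_ 0ℚ

Πℚ : List ℚ → ℚ
Πℚ = List.foldr _*_ 1ℚ

ι : ℕ → ℚ
ι n = + n / 1

_^ℚ_ : ℚ → ℕ → ℚ
θ ^ℚ zero = 1ℚ
θ ^ℚ suc n = θ * (θ ^ℚ n)

rising : ℚ → ℕ → ℚ
rising θ k = Πℚ (applyUpTo (λ i → θ + ι i) k)

-- the integers a, a+1, ..., b (empty if b < a)
range : ℕ → ℕ → List ℕ
range a b = applyUpTo (λ t → a ℕ.+ t) (suc b ℕ.∸ a)

c₁ : ℕ → ℕ → ℕ
c₁ N k = List.foldr ℕ._*_ 1 (range (suc k) (N ℕ.∸ 1))

-- H(N,k) = ∑_{i=k+1}^{N-1} 1/i ; written with i = suc j, j = k .. N-2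
H : ℕ → ℕ → ℚ
H N k = Σℚ (List.map (λ j → + 1 / suc j) (range k (N ℕ.∸ 2)))

-- The symmetric group S_N as all injective words of length N over
-- {1,...,N}: enumerate all maps Fin N → Fin N (as vectors), keep the
-- injective ones, and record the one-line notation with values 1..N.

allVecs : (m n : ℕ) → List (Vec (Fin m) n)
allVecs m zero = Vec.[] ∷ []
allVecs m (suc n) =
  List.concatMap (λ x → List.map (x Vec.∷_) (allVecs m n)) (allFin m)

oneLine : ∀ {N} → Vec (Fin N) N → List ℕ
oneLine v = List.map (λ i → suc (toℕ i)) (Vec.toList v)

isPerm : ∀ {N} → Vec (Fin N) N → Bool
isPerm v = does (UDec.unique? FinP._≟_ (Vec.toList v))

perms : ℕ → List (List ℕ)
perms N = List.map oneLine (List.filterᵇ isPerm (allVecs N N))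

exceedsAll : List ℕ → ℕ → Bool
exceedsAll seen x = List.foldr (λ y b → (y <ᵇ x) Data.Bool.∧ b) true seen

lrmAux : List ℕ → List ℕ → ℕ
lrmAux seen [] = 0
lrmAux seen (x ∷ xs) =
  (if exceedsAll seen x then 1 else 0) ℕ.+ lrmAux (x ∷ seen) xs

lrm : List ℕ → ℕ
lrm = lrmAux []

-- the strategy: reject the first k entries, then accept the first
-- subsequent left-to-right maximum (nothing if there is none)

selectAux : ℕ → List ℕ → List ℕ → Maybe ℕ
selectAux k seen [] = nothing
selectAux zero seen (x ∷ xs) =
  if exceedsAll seen x then just x else selectAux zero (x ∷ seen) xs
selectAux (suc k) seen (x ∷ xs) = selectAux k (x ∷ seen) xs

select : ℕ → List ℕ → Maybe ℕ
select k π = selectAux k [] π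

winnableᵇ : ℕ → ℕ → List ℕ → Bool
winnableᵇ N k π with select k π
... | just x = does (x ℕ.≟ N)
... | nothing = false

W : ℕ → ℕ → ℚ → ℚ
W N k θ = Σℚ (List.map (λ π → θ ^ℚ lrm π) (List.filterᵇ (winnableᵇ N k) (perms N)))

ΔW : ℕ → ℕ → ℚ → ℚ
ΔW N k θ = W N (suc k) θ - W N k θ

module Submission where

-- Split a permutation into its first k entries and the rest. After a prefix with maximum M, the strategy
-- wins exactly when N is the first of the N − M larger values to appear, and N is then the only further
-- record; so the completions contribute θ (N − k)! / (N − M), depending on the prefix only through M.
-- The prefixes of length k with maximum M have total weight [θ]_k C(M − 1, k − 1), so
--   W(N, k) = [θ]_k θ (N − k)! Σ_{M<N} C(M − 1, k − 1) / (N − M).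
-- Passing from k to k + 1, the extra prefix entry is either a new record (factor θ) or one of the unused
-- smaller values; with Pascal's rule the difference collapses to
--   [θ]_k θ (N − 1 − k)! C(N − 1, k) (θ (H_{N−1} − H_k) − 1) = c₁(N, k) (H θ − 1) θ [θ]_k,
-- whose roots 1/H, 0, −1, ..., −(k − 1) are read off directly.

module WinnablePermutations where

  open import Defs
  open import Data.Nat as ℕ using (ℕ; zero; suc; _≤_; _<_; _∸_; _⊔_; _<ᵇ_; _≡ᵇ_; z≤n; s≤s; _!)
  import Data.Nat.Properties as NP
  import Data.Nat.Solver as ℕSolver
  open import Data.Bool using (Bool; true; false; if_then_else_; _∨_; _∧_; not; T)
  import Data.Bool.Properties as BP
  open import Data.Unit using (⊤; tt)
  open import Data.Empty using (⊥-elim)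
  open import Data.Maybe using (Maybe; just; nothing)
  open import Data.Product using (_×_; _,_; ∃-syntax)
  open import Data.Fin using (Fin; toℕ) renaming (zero to fz; suc to fs)
  import Data.Fin.Properties as FinP
  open import Data.Vec as Vec using (Vec)
  open import Data.List as List using (List; []; _∷_; _++_; map; applyUpTo; concatMap; length; reverse; foldr)
  import Data.List.Properties as LP
  import Data.List.Relation.Unary.All as All
  import Data.List.Relation.Unary.Unique.DecPropositional as UDec
  open import Data.List.Membership.Propositional using (_∈_)
  import Data.List.Membership.Propositional.Properties as LMP
  open import Data.List.Relation.Unary.Any using (here; there)
  import Data.Integer as ℤ
  import Data.Integer.Properties as ZP
  open import Data.Rational as Q using (ℚ; 0ℚ; 1ℚ; _+_; _*_; _-_; -_; toℚᵘ)
  import Data.Rational.Properties as QP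
  open import Data.Rational.Unnormalised as U using (mkℚᵘ; *≡*)
  import Data.Rational.Unnormalised.Properties as UP
  open import Data.Rational.Solver using (module +-*-Solver)
  open import Function using (_∘_; id)
  open import Function.Bundles using (Equivalence)
  open import Relation.Binary.PropositionalEquality
  open import Relation.Nullary using (yes; no; ¬_; does; ¬?; T?)

  open +-*-Solver
  open ℕSolver.+-*-Solver using () renaming (solve to ℕsolve; _:+_ to _:+ℕ_; _:*_ to _:*ℕ_; _:=_ to _:=ℕ_)

  -- Rational arithmetic and finite sums

  ι-as-ℚᵘ : ∀ n → toℚᵘ (ι n) U.≃ mkℚᵘ (ℤ.+ n) 0
  ι-as-ℚᵘ n = QP.toℚᵘ-fromℚᵘ (mkℚᵘ (ℤ.+ n) 0)

  ι-homo-+ : ∀ m n → ι (m ℕ.+ n) ≡ ι m + ι n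
  ι-homo-+ m n = QP.toℚᵘ-injective (UP.≃-trans (ι-as-ℚᵘ (m ℕ.+ n)) (UP.≃-trans unnormalised
    (UP.≃-sym (UP.≃-trans (QP.toℚᵘ-homo-+ (ι m) (ι n)) (UP.+-cong (ι-as-ℚᵘ m) (ι-as-ℚᵘ n))))))
    where
    unnormalised : mkℚᵘ (ℤ.+ (m ℕ.+ n)) 0 U.≃ mkℚᵘ (ℤ.+ m) 0 U.+ mkℚᵘ (ℤ.+ n) 0
    unnormalised = *≡* (cong (ℤ._* ℤ.+ 1) (cong₂ ℤ._+_ (sym (ZP.*-identityʳ (ℤ.+ m))) (sym (ZP.*-identityʳ (ℤ.+ n)))))

  ι-homo-* : ∀ m n → ι (m ℕ.* n) ≡ ι m * ι n
  ι-homo-* m n = QP.toℚᵘ-injective (UP.≃-trans (ι-as-ℚᵘ (m ℕ.* n)) (UP.≃-trans unnormalised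
    (UP.≃-sym (UP.≃-trans (QP.toℚᵘ-homo-* (ι m) (ι n)) (UP.*-cong (ι-as-ℚᵘ m) (ι-as-ℚᵘ n))))))
    where
    unnormalised : mkℚᵘ (ℤ.+ (m ℕ.* n)) 0 U.≃ mkℚᵘ (ℤ.+ m) 0 U.* mkℚᵘ (ℤ.+ n) 0
    unnormalised = *≡* (cong (ℤ._* ℤ.+ 1) (ZP.pos-* m n))

  1/suc : ℕ → ℚ
  1/suc j = ℤ.+ 1 Q./ suc j

  ι-suc*1/suc≡1 : ∀ j → ι (suc j) * 1/suc j ≡ 1ℚ
  ι-suc*1/suc≡1 j = QP.toℚᵘ-injective (UP.≃-trans (QP.toℚᵘ-homo-* (ι (suc j)) (1/suc j))
    (UP.≃-trans (UP.*-cong (ι-as-ℚᵘ (suc j)) (QP.toℚᵘ-fromℚᵘ (mkℚᵘ (ℤ.+ 1) j))) unnormalised))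
    where
    unnormalised : mkℚᵘ (ℤ.+ suc j) 0 U.* mkℚᵘ (ℤ.+ 1) j U.≃ U.1ℚᵘ
    unnormalised = *≡* (cong ℤ.+_ (cong suc (trans (trans (NP.*-identityʳ _) (NP.*-identityʳ j))
                     (sym (trans (NP.+-identityʳ (j ℕ.+ 0)) (NP.+-identityʳ j))))))

  cross-multiply : ∀ x y k m → x * ι (suc k) ≡ y * ι (suc m) → x * 1/suc m ≡ y * 1/suc k
  cross-multiply x y k m e = begin
      x * 1/suc m
        ≡⟨ sym (QP.*-identityʳ _) ⟩
      x * 1/suc m * 1ℚ
        ≡⟨ cong (x * 1/suc m *_) (sym (ι-suc*1/suc≡1 k)) ⟩
      x * 1/suc m * (ι (suc k) * 1/suc k)
        ≡⟨ solve 4 (λ x a b c → x :* a :* (b :* c) := x :* b :* a :* c) refl x (1/suc m) (ι (suc k)) (1/suc k) ⟩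
      x * ι (suc k) * 1/suc m * 1/suc k
        ≡⟨ cong (λ z → z * 1/suc m * 1/suc k) e ⟩
      y * ι (suc m) * 1/suc m * 1/suc k
        ≡⟨ solve 4 (λ y b a c → y :* b :* a :* c := y :* c :* (b :* a)) refl y (ι (suc m)) (1/suc m) (1/suc k) ⟩
      y * 1/suc k * (ι (suc m) * 1/suc m)
        ≡⟨ cong (y * 1/suc k *_) (ι-suc*1/suc≡1 m) ⟩
      y * 1/suc k * 1ℚ
        ≡⟨ QP.*-identityʳ _ ⟩
      y * 1/suc k ∎
    where open ≡-Reasoning

  ^ℚ-+ : ∀ θ a b → θ ^ℚ (a ℕ.+ b) ≡ θ ^ℚ a * θ ^ℚ b
  ^ℚ-+ θ zero b = sym (QP.*-identityˡ _)
  ^ℚ-+ θ (suc a) b = trans (cong (θ *_) (^ℚ-+ θ a b)) (sym (QP.*-assoc θ _ _))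

  rising-suc : ∀ θ k → rising θ (suc k) ≡ rising θ k * (θ + ι k)
  rising-suc θ k = Πℚ-applyUpTo-suc (λ i → θ + ι i) k
    where
    Πℚ-applyUpTo-suc : ∀ (f : ℕ → ℚ) k → Πℚ (applyUpTo f (suc k)) ≡ Πℚ (applyUpTo f k) * f k
    Πℚ-applyUpTo-suc f zero = QP.*-comm (f 0) 1ℚ
    Πℚ-applyUpTo-suc f (suc k) = trans (cong (f 0 *_) (Πℚ-applyUpTo-suc (λ i → f (suc i)) k)) (sym (QP.*-assoc (f 0) _ _))

  *-distribˡ-- : ∀ a b c → a * (b - c) ≡ a * b - a * c
  *-distribˡ-- = solve 3 (λ a b c → a :* (b :- c) := a :* b :- a :* c) refl

  applyUpTo-cong : ∀ {A : Set} (f g : ℕ → A) d → (∀ t → f t ≡ g t) → applyUpTo f d ≡ applyUpTo g d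
  applyUpTo-cong f g zero eq = refl
  applyUpTo-cong f g (suc d) eq = cong₂ _∷_ (eq 0) (applyUpTo-cong (f ∘ suc) (g ∘ suc) d (eq ∘ suc))

  sumOver : {A : Set} → List A → (A → ℚ) → ℚ
  sumOver xs F = Σℚ (map F xs)

  module _ {A : Set} where

    sumOver-++ : (xs ys : List A) (F : A → ℚ) → sumOver (xs ++ ys) F ≡ sumOver xs F + sumOver ys F
    sumOver-++ [] ys F = sym (QP.+-identityˡ _)
    sumOver-++ (x ∷ xs) ys F = trans (cong (F x +_) (sumOver-++ xs ys F)) (sym (QP.+-assoc (F x) _ _))

    sumOver-concatMap : {B : Set} (G : B → List A) (ys : List B) (F : A → ℚ) →
      sumOver (concatMap G ys) F ≡ sumOver ys (λ y → sumOver (G y) F)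
    sumOver-concatMap G [] F = refl
    sumOver-concatMap G (y ∷ ys) F = trans (sumOver-++ (G y) (concatMap G ys) F) (cong (sumOver (G y) F +_) (sumOver-concatMap G ys F))

    sumOver-map : {B : Set} (f : B → A) (ys : List B) (F : A → ℚ) → sumOver (map f ys) F ≡ sumOver ys (λ y → F (f y))
    sumOver-map f [] F = refl
    sumOver-map f (y ∷ ys) F = cong (F (f y) +_) (sumOver-map f ys F)

    sumOver-cong : (xs : List A) {F G : A → ℚ} → (∀ x → F x ≡ G x) → sumOver xs F ≡ sumOver xs G
    sumOver-cong [] eq = refl
    sumOver-cong (x ∷ xs) eq = cong₂ _+_ (eq x) (sumOver-cong xs eq)

    sumOver-scale : (xs : List A) (c : ℚ) (F : A → ℚ) → sumOver xs (λ x → c * F x) ≡ c * sumOver xs F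
    sumOver-scale [] c F = sym (QP.*-zeroʳ c)
    sumOver-scale (x ∷ xs) c F = trans (cong (c * F x +_) (sumOver-scale xs c F)) (sym (QP.*-distribˡ-+ c (F x) _))

    sumOver-zero : (xs : List A) → sumOver xs (λ _ → 0ℚ) ≡ 0ℚ
    sumOver-zero [] = refl
    sumOver-zero (x ∷ xs) = trans (QP.+-identityˡ _) (sumOver-zero xs)

    sumOver-filterᵇ : (p : A → Bool) (xs : List A) (F : A → ℚ) →
      sumOver (List.filterᵇ p xs) F ≡ sumOver xs (λ x → if p x then F x else 0ℚ)
    sumOver-filterᵇ p [] F = refl
    sumOver-filterᵇ p (x ∷ xs) F with p x
    ... | true = cong (F x +_) (sumOver-filterᵇ p xs F)
    ... | false = trans (sumOver-filterᵇ p xs F) (sym (QP.+-identityˡ _))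

  sumBelow : ℕ → (ℕ → ℚ) → ℚ
  sumBelow zero f = 0ℚ
  sumBelow (suc n) f = sumBelow n f + f n

  sumBelow-head : ∀ n f → sumBelow (suc n) f ≡ f 0 + sumBelow n (λ i → f (suc i))
  sumBelow-head zero f = trans (QP.+-identityˡ (f 0)) (sym (QP.+-identityʳ (f 0)))
  sumBelow-head (suc n) f = trans (cong (_+ f (suc n)) (sumBelow-head n f)) (QP.+-assoc (f 0) _ _)

  sumOver-applyUpTo : ∀ (g : ℕ → ℕ) n (F : ℕ → ℚ) → sumOver (applyUpTo g n) F ≡ sumBelow n (λ i → F (g i))
  sumOver-applyUpTo g zero F = refl
  sumOver-applyUpTo g (suc n) F = trans (cong (F (g 0) +_) (sumOver-applyUpTo (λ i → g (suc i)) n F))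
    (sym (sumBelow-head n (λ i → F (g i))))

  sumBelow-cong : ∀ n {f g : ℕ → ℚ} → (∀ i → i < n → f i ≡ g i) → sumBelow n f ≡ sumBelow n g
  sumBelow-cong zero eq = refl
  sumBelow-cong (suc n) eq = cong₂ _+_ (sumBelow-cong n (λ i i<n → eq i (NP.m<n⇒m<1+n i<n))) (eq n (NP.n<1+n n))

  sumBelow-+ : ∀ m d f → sumBelow (m ℕ.+ d) f ≡ sumBelow m f + sumBelow d (λ i → f (m ℕ.+ i))
  sumBelow-+ m zero f = trans (cong (λ z → sumBelow z f) (NP.+-identityʳ m)) (sym (QP.+-identityʳ _))
  sumBelow-+ m (suc d) f = trans (cong (λ z → sumBelow z f) (NP.+-suc m d))
    (trans (cong (_+ f (m ℕ.+ d)) (sumBelow-+ m d f)) (QP.+-assoc (sumBelow m f) _ _))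

  sumBelow-scale : ∀ n c f → sumBelow n (λ i → c * f i) ≡ c * sumBelow n f
  sumBelow-scale zero c f = sym (QP.*-zeroʳ c)
  sumBelow-scale (suc n) c f = trans (cong (_+ c * f n) (sumBelow-scale n c f)) (sym (QP.*-distribˡ-+ c _ _))

  sumBelow-scaleʳ : ∀ n c f → sumBelow n (λ i → f i * c) ≡ sumBelow n f * c
  sumBelow-scaleʳ n c f = trans (sumBelow-cong n (λ i _ → QP.*-comm (f i) c))
    (trans (sumBelow-scale n c f) (QP.*-comm c (sumBelow n f)))

  sumBelow-distrib-+ : ∀ n f g → sumBelow n (λ i → f i + g i) ≡ sumBelow n f + sumBelow n g
  sumBelow-distrib-+ zero f g = refl
  sumBelow-distrib-+ (suc n) f g = trans (cong (_+ (f n + g n)) (sumBelow-distrib-+ n f g))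
    (solve 4 (λ a b c d → (a :+ b) :+ (c :+ d) := (a :+ c) :+ (b :+ d)) refl (sumBelow n f) (sumBelow n g) (f n) (g n))

  sumBelow-distrib-- : ∀ n f g → sumBelow n (λ i → f i - g i) ≡ sumBelow n f - sumBelow n g
  sumBelow-distrib-- zero f g = refl
  sumBelow-distrib-- (suc n) f g = trans (cong (_+ (f n - g n)) (sumBelow-distrib-- n f g))
    (solve 4 (λ a b c d → (a :- b) :+ (c :- d) := (a :+ c) :- (b :+ d)) refl (sumBelow n f) (sumBelow n g) (f n) (g n))

  sumBelow-zero : ∀ n f → (∀ i → i < n → f i ≡ 0ℚ) → sumBelow n f ≡ 0ℚ
  sumBelow-zero zero f eq = refl
  sumBelow-zero (suc n) f eq = trans (cong₂ _+_ (sumBelow-zero n f (λ i i<n → eq i (NP.m<n⇒m<1+n i<n))) (eq n (NP.n<1+n n)))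
    (QP.+-identityˡ 0ℚ)

  m<n⇒n∸m≡1+[n∸1+m] : ∀ {m n} → m < n → n ∸ m ≡ suc (n ∸ suc m)
  m<n⇒n∸m≡1+[n∸1+m] = NP.+-∸-assoc 1

  sumBelow-swap : ∀ L (a h : ℕ → ℚ) →
    sumBelow L (λ M → a M * sumBelow (L ∸ suc M) (λ i → h (suc (M ℕ.+ i)))) ≡ sumBelow L (λ x → sumBelow x a * h x)
  sumBelow-swap zero a h = refl
  sumBelow-swap (suc L) a h = begin
      sumBelow L (λ M → a M * tail (L ∸ M) M) + a L * tail (L ∸ L) L
        ≡⟨ cong₂ _+_ (sumBelow-cong L split-last) empty-tail ⟩
      sumBelow L (λ M → a M * tail (L ∸ suc M) M + a M * h L) + 0ℚ
        ≡⟨ trans (QP.+-identityʳ _) (sumBelow-distrib-+ L _ _) ⟩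
      sumBelow L (λ M → a M * tail (L ∸ suc M) M) + sumBelow L (λ M → a M * h L)
        ≡⟨ cong₂ _+_ (sumBelow-swap L a h) (sumBelow-scaleʳ L (h L) a) ⟩
      sumBelow L (λ x → sumBelow x a * h x) + sumBelow L a * h L ∎
    where
    open ≡-Reasoning
    tail : ℕ → ℕ → ℚ
    tail n M = sumBelow n (λ i → h (suc (M ℕ.+ i)))
    split-last : ∀ M → M < L → a M * tail (L ∸ M) M ≡ a M * tail (L ∸ suc M) M + a M * h L
    split-last M M<L = trans (cong (λ z → a M * tail z M) (m<n⇒n∸m≡1+[n∸1+m] M<L))
      (trans (cong (λ z → a M * (tail (L ∸ suc M) M + h z)) (NP.m+[n∸m]≡n M<L)) (QP.*-distribˡ-+ (a M) _ _))
    empty-tail : a L * tail (L ∸ L) L ≡ 0ℚ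
    empty-tail = trans (cong (λ z → a L * tail z L) (NP.n∸n≡0 L)) (QP.*-zeroʳ (a L))

  cong₃ : ∀ {A B C D : Set} (f : A → B → C → D) {a a′ b b′ c c′} → a ≡ a′ → b ≡ b′ → c ≡ c′ → f a b c ≡ f a′ b′ c′
  cong₃ f refl refl refl = refl

  if-true : {A : Set} {b : Bool} (x y : A) → b ≡ true → (if b then x else y) ≡ x
  if-true x y refl = refl

  if-false : {A : Set} {b : Bool} (x y : A) → b ≡ false → (if b then x else y) ≡ y
  if-false x y refl = refl

  ≡ᵇ-refl : ∀ n → (n ≡ᵇ n) ≡ true
  ≡ᵇ-refl zero = refl
  ≡ᵇ-refl (suc n) = ≡ᵇ-refl n

  ≡ᵇ-true⇒≡ : ∀ m n → (m ≡ᵇ n) ≡ true → m ≡ n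
  ≡ᵇ-true⇒≡ m n e = NP.≡ᵇ⇒≡ m n (Equivalence.from BP.T-≡ e)

  ≡⇒≡ᵇ-true : ∀ {m n} → m ≡ n → (m ≡ᵇ n) ≡ true
  ≡⇒≡ᵇ-true {m} refl = ≡ᵇ-refl m

  ¬T⇒≡false : ∀ {b} → ¬ T b → b ≡ false
  ¬T⇒≡false {false} _ = refl
  ¬T⇒≡false {true} ¬T = ⊥-elim (¬T tt)

  ≢⇒≡ᵇ-false : ∀ m n → m ≢ n → (m ≡ᵇ n) ≡ false
  ≢⇒≡ᵇ-false m n m≢n = ¬T⇒≡false (λ T[m≡ᵇn] → m≢n (NP.≡ᵇ⇒≡ m n T[m≡ᵇn]))

  <⇒<ᵇ-true : ∀ m n → m < n → (m <ᵇ n) ≡ true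
  <⇒<ᵇ-true m n m<n = Equivalence.to BP.T-≡ (NP.<⇒<ᵇ m<n)

  ≥⇒<ᵇ-false : ∀ m n → n ≤ m → (m <ᵇ n) ≡ false
  ≥⇒<ᵇ-false m n n≤m = ¬T⇒≡false (λ T[m<ᵇn] → NP.<⇒≱ (NP.<ᵇ⇒< m n T[m<ᵇn]) n≤m)

  <ᵇ-true⇒< : ∀ m n → (m <ᵇ n) ≡ true → m < n
  <ᵇ-true⇒< m n e = NP.<ᵇ⇒< m n (Equivalence.from BP.T-≡ e)

  <ᵇ-false⇒≥ : ∀ m n → (m <ᵇ n) ≡ false → n ≤ m
  <ᵇ-false⇒≥ m n e = NP.≮⇒≥ (λ m<n → subst T e (NP.<⇒<ᵇ m<n))

  -- Injective words

  _∈ᵇ_ : ℕ → List ℕ → Bool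
  x ∈ᵇ [] = false
  x ∈ᵇ (y ∷ s) = (x ≡ᵇ y) ∨ (x ∈ᵇ s)

  listMax : List ℕ → ℕ
  listMax = foldr _⊔_ 0

  -- A state s lists the values seen so far, most recent first (as in lrmAux and selectAux).
  injWords : ℕ → List ℕ → ℕ → List (List ℕ)
  injWords N s zero = [] ∷ []
  injWords N s (suc n) =
    concatMap (λ x → if x ∈ᵇ s then [] else map (x ∷_) (injWords N (x ∷ s) n)) (applyUpTo suc N)

  sum-injWords-suc : ∀ N s n (F : List ℕ → ℚ) → sumOver (injWords N s (suc n)) F ≡
    sumBelow N (λ i → if suc i ∈ᵇ s then 0ℚ else sumOver (injWords N (suc i ∷ s) n) (λ w → F (suc i ∷ w)))
  sum-injWords-suc N s n F = trans (sumOver-concatMap _ (applyUpTo suc N) F)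
    (trans (sumOver-applyUpTo suc N _) (sumBelow-cong N (λ i _ → branch (suc i ∈ᵇ s) (suc i))))
    where
    branch : ∀ b x → sumOver (if b then [] else map (x ∷_) (injWords N (x ∷ s) n)) F
                   ≡ (if b then 0ℚ else sumOver (injWords N (x ∷ s) n) (λ w → F (x ∷ w)))
    branch true x = refl
    branch false x = sumOver-map (x ∷_) (injWords N (x ∷ s) n) F

  reverse-∷-++ : ∀ {X : Set} (x : X) p s → reverse (x ∷ p) ++ s ≡ reverse p ++ x ∷ s
  reverse-∷-++ x p s = trans (cong (_++ s) (LP.unfold-reverse x p)) (LP.++-assoc (reverse p) (x ∷ []) s)

  sum-injWords-suc-cong : ∀ N s n m (F G : List ℕ → ℚ) →
    (∀ x → 1 ≤ x → x ≤ N → x ∈ᵇ s ≡ false →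
       sumOver (injWords N (x ∷ s) n) (λ w → F (x ∷ w)) ≡ sumOver (injWords N (x ∷ s) m) (λ w → G (x ∷ w))) →
    sumOver (injWords N s (suc n)) F ≡ sumOver (injWords N s (suc m)) G
  sum-injWords-suc-cong N s n m F G first-letter =
    trans (sum-injWords-suc N s n F) (trans (sumBelow-cong N letterwise) (sym (sum-injWords-suc N s m G)))
    where
    letterwise : ∀ i → i < N →
      (if suc i ∈ᵇ s then 0ℚ else sumOver (injWords N (suc i ∷ s) n) (λ w → F (suc i ∷ w))) ≡
      (if suc i ∈ᵇ s then 0ℚ else sumOver (injWords N (suc i ∷ s) m) (λ w → G (suc i ∷ w)))
    letterwise i i<N with suc i ∈ᵇ s in i∉s
    ... | true = refl
    ... | false = first-letter (suc i) (s≤s z≤n) i<N i∉s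

  ⊔-<ᵇ : ∀ a b x → ((a ⊔ b) <ᵇ x) ≡ ((a <ᵇ x) ∧ (b <ᵇ x))
  ⊔-<ᵇ zero b zero = refl
  ⊔-<ᵇ zero b (suc x) = refl
  ⊔-<ᵇ (suc a) zero zero = refl
  ⊔-<ᵇ (suc a) zero (suc x) = sym (BP.∧-identityʳ _)
  ⊔-<ᵇ (suc a) (suc b) zero = refl
  ⊔-<ᵇ (suc a) (suc b) (suc x) = ⊔-<ᵇ a b x

  exceedsAll≡listMax<ᵇ : ∀ s x → 1 ≤ x → exceedsAll s x ≡ (listMax s <ᵇ x)
  exceedsAll≡listMax<ᵇ [] (suc x) _ = refl
  exceedsAll≡listMax<ᵇ (y ∷ s) x 1≤x =
    trans (cong ((y <ᵇ x) ∧_) (exceedsAll≡listMax<ᵇ s x 1≤x)) (sym (⊔-<ᵇ y (listMax s) x))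

  listMax<⇒∉ᵇ : ∀ s x → listMax s < x → (x ∈ᵇ s) ≡ false
  listMax<⇒∉ᵇ [] x _ = refl
  listMax<⇒∉ᵇ (y ∷ s) x max<x =
    trans (cong (_∨ (x ∈ᵇ s)) (≢⇒≡ᵇ-false x y (λ x≡y → NP.<⇒≢ (NP.≤-<-trans (NP.m≤m⊔n y (listMax s)) max<x) (sym x≡y))))
          (listMax<⇒∉ᵇ s x (NP.≤-<-trans (NP.m≤n⊔m y (listMax s)) max<x))

  listMax-++ : ∀ xs ys → listMax (xs ++ ys) ≡ listMax xs ⊔ listMax ys
  listMax-++ [] ys = refl
  listMax-++ (x ∷ xs) ys = trans (cong (x ⊔_) (listMax-++ xs ys)) (sym (NP.⊔-assoc x (listMax xs) (listMax ys)))

  listMax-reverse : ∀ xs → listMax (reverse xs) ≡ listMax xs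
  listMax-reverse [] = refl
  listMax-reverse (x ∷ xs) = trans (cong listMax (LP.unfold-reverse x xs))
    (trans (listMax-++ (reverse xs) (x ∷ []))
    (trans (cong₂ _⊔_ (listMax-reverse xs) (NP.⊔-identityʳ x)) (NP.⊔-comm (listMax xs) x)))

  Distinct : List ℕ → Set
  Distinct [] = ⊤
  Distinct (x ∷ s) = (x ∈ᵇ s ≡ false) × Distinct s

  AllPositive : List ℕ → Set
  AllPositive [] = ⊤
  AllPositive (x ∷ s) = (1 ≤ x) × AllPositive s

  ValidState : ℕ → List ℕ → Set
  ValidState N s = Distinct s × AllPositive s × (listMax s ≤ N)

  ValidState-∷ : ∀ {N s x} → ValidState N s → 1 ≤ x → x ≤ N → x ∈ᵇ s ≡ false → ValidState N (x ∷ s)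
  ValidState-∷ (dist , pos , max≤N) 1≤x x≤N x∉s = (x∉s , dist) , (1≤x , pos) , NP.⊔-lub x≤N max≤N

  ValidState-[] : ∀ {N} → ValidState N []
  ValidState-[] = tt , tt , z≤n

  sum-injWords-+ : ∀ N j n s (F : List ℕ → ℚ) → sumOver (injWords N s (j ℕ.+ n)) F ≡
    sumOver (injWords N s j) (λ p → sumOver (injWords N (reverse p ++ s) n) (λ w → F (p ++ w)))
  sum-injWords-+ N zero n s F = sym (QP.+-identityʳ _)
  sum-injWords-+ N (suc j) n s F = sum-injWords-suc-cong N s (j ℕ.+ n) j F _ (λ x _ _ _ →
    trans (sum-injWords-+ N j n (x ∷ s) (λ w → F (x ∷ w)))
          (sumOver-cong (injWords N (x ∷ s) j) (λ p → cong (λ t → sumOver (injWords N t n) (λ w → F (x ∷ p ++ w)))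
                                                          (sym (reverse-∷-++ x p s)))))

  sum-injWords-cong : ∀ N n s (F G : List ℕ → ℚ) → ValidState N s →
    (∀ p → ValidState N (reverse p ++ s) → length p ≡ n → F p ≡ G p) →
    sumOver (injWords N s n) F ≡ sumOver (injWords N s n) G
  sum-injWords-cong N zero s F G valid F≗G = cong (_+ 0ℚ) (F≗G [] valid refl)
  sum-injWords-cong N (suc n) s F G valid F≗G = sum-injWords-suc-cong N s n n F G (λ x 1≤x x≤N x∉s →
    sum-injWords-cong N n (x ∷ s) _ _ (ValidState-∷ valid 1≤x x≤N x∉s) (λ p valid′ length≡n →
      F≗G (x ∷ p) (subst (ValidState N) (sym (reverse-∷-++ x p s)) valid′) (cong suc length≡n)))

  sumBelowℕ : ℕ → (ℕ → ℕ) → ℕ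
  sumBelowℕ zero f = 0
  sumBelowℕ (suc n) f = sumBelowℕ n f ℕ.+ f n

  sumBelowℕ-cong : ∀ n {f g : ℕ → ℕ} → (∀ i → i < n → f i ≡ g i) → sumBelowℕ n f ≡ sumBelowℕ n g
  sumBelowℕ-cong zero eq = refl
  sumBelowℕ-cong (suc n) eq = cong₂ ℕ._+_ (sumBelowℕ-cong n (λ i i<n → eq i (NP.m<n⇒m<1+n i<n))) (eq n (NP.n<1+n n))

  sumBelowℕ-distrib-+ : ∀ n f g → sumBelowℕ n (λ i → f i ℕ.+ g i) ≡ sumBelowℕ n f ℕ.+ sumBelowℕ n g
  sumBelowℕ-distrib-+ zero f g = refl
  sumBelowℕ-distrib-+ (suc n) f g = trans (cong (ℕ._+ (f n ℕ.+ g n)) (sumBelowℕ-distrib-+ n f g))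
    (ℕsolve 4 (λ a b c d → (a :+ℕ b) :+ℕ (c :+ℕ d) :=ℕ (a :+ℕ c) :+ℕ (b :+ℕ d)) refl (sumBelowℕ n f) (sumBelowℕ n g) (f n) (g n))

  sumBelowℕ-const : ∀ n c → sumBelowℕ n (λ _ → c) ≡ n ℕ.* c
  sumBelowℕ-const zero c = refl
  sumBelowℕ-const (suc n) c = trans (cong (ℕ._+ c) (sumBelowℕ-const n c)) (NP.+-comm (n ℕ.* c) c)

  sumBelowℕ-zero : ∀ n → sumBelowℕ n (λ _ → 0) ≡ 0
  sumBelowℕ-zero n = trans (sumBelowℕ-const n 0) (NP.*-zeroʳ n)

  ι-sumBelowℕ : ∀ n f → ι (sumBelowℕ n f) ≡ sumBelow n (λ i → ι (f i))
  ι-sumBelowℕ zero f = refl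
  ι-sumBelowℕ (suc n) f = trans (ι-homo-+ (sumBelowℕ n f) (f n)) (cong (_+ ι (f n)) (ι-sumBelowℕ n f))

  indicator : Bool → ℕ
  indicator b = if b then 1 else 0

  count : ℕ → (ℕ → Bool) → ℕ
  count n P = sumBelowℕ n (λ i → indicator (P i))

  count-≤ : ∀ n P → count n P ≤ n
  count-≤ zero P = z≤n
  count-≤ (suc n) P = NP.≤-trans (NP.+-mono-≤ (count-≤ n P) (indicator≤1 (P n))) (NP.≤-reflexive (NP.+-comm n 1))
    where
    indicator≤1 : ∀ b → indicator b ≤ 1
    indicator≤1 true = NP.≤-refl
    indicator≤1 false = z≤n

  count-not+count : ∀ n P → count n (λ i → not (P i)) ℕ.+ count n P ≡ n
  count-not+count n P = trans (sym (sumBelowℕ-distrib-+ n _ _))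
    (trans (sumBelowℕ-cong n (λ i _ → indicator-not+indicator (P i))) (trans (sumBelowℕ-const n 1) (NP.*-identityʳ n)))
    where
    indicator-not+indicator : ∀ b → indicator (not b) ℕ.+ indicator b ≡ 1
    indicator-not+indicator true = refl
    indicator-not+indicator false = refl

  count-≡ᵇ-above : ∀ B y → B < y → count B (λ i → suc i ≡ᵇ y) ≡ 0
  count-≡ᵇ-above B y B<y =
    trans (sumBelowℕ-cong B (λ i i<B → cong indicator (≢⇒≡ᵇ-false (suc i) y (NP.<⇒≢ (NP.≤-<-trans i<B B<y)))))
          (sumBelowℕ-zero B)

  count-≡ᵇ-within : ∀ B y → 1 ≤ y → y ≤ B → count B (λ i → suc i ≡ᵇ y) ≡ 1
  count-≡ᵇ-within zero y 1≤y y≤0 = ⊥-elim (NP.<⇒≱ 1≤y y≤0)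
  count-≡ᵇ-within (suc B) y 1≤y y≤B with y ℕ.≟ suc B
  ... | yes refl = cong₂ ℕ._+_ (count-≡ᵇ-above B (suc B) (NP.n<1+n B)) (cong indicator (≡ᵇ-refl B))
  ... | no y≢B = cong₂ ℕ._+_ (count-≡ᵇ-within B y 1≤y (NP.≤-pred (NP.≤∧≢⇒< y≤B y≢B)))
                             (cong indicator (≢⇒≡ᵇ-false (suc B) y (λ e → y≢B (sym e))))

  count-∈ᵇ : ∀ B s → Distinct s → AllPositive s → listMax s ≤ B → count B (λ i → suc i ∈ᵇ s) ≡ length s
  count-∈ᵇ B [] _ _ _ = sumBelowℕ-zero B
  count-∈ᵇ B (y ∷ s) (y∉s , dist) (1≤y , pos) max≤B =
    trans (sumBelowℕ-cong B (λ i _ → indicator-∈ᵇ-∷ (suc i)))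
    (trans (sumBelowℕ-distrib-+ B _ _)
           (cong₂ ℕ._+_ (count-≡ᵇ-within B y 1≤y (NP.≤-trans (NP.m≤m⊔n y (listMax s)) max≤B))
                        (count-∈ᵇ B s dist pos (NP.≤-trans (NP.m≤n⊔m y (listMax s)) max≤B))))
    where
    indicator-∈ᵇ-∷ : ∀ x → indicator (x ∈ᵇ (y ∷ s)) ≡ indicator (x ≡ᵇ y) ℕ.+ indicator (x ∈ᵇ s)
    indicator-∈ᵇ-∷ x with x ≡ᵇ y in x≡ᵇy
    ... | true = cong (λ b → 1 ℕ.+ indicator b) (sym (trans (cong (_∈ᵇ s) (≡ᵇ-true⇒≡ x y x≡ᵇy)) y∉s))
    ... | false = refl

  length≤listMax : ∀ s → Distinct s → AllPositive s → length s ≤ listMax s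
  length≤listMax s dist pos =
    subst (_≤ listMax s) (count-∈ᵇ (listMax s) s dist pos NP.≤-refl) (count-≤ (listMax s) (λ i → suc i ∈ᵇ s))

  sumBelow-unseen-const : ∀ B s → Distinct s → AllPositive s → listMax s ≤ B → ∀ c →
    sumBelow B (λ i → if suc i ∈ᵇ s then 0ℚ else c) ≡ ι (B ∸ length s) * c
  sumBelow-unseen-const B s dist pos max≤B c =
    trans (sumBelow-if B (λ i → suc i ∈ᵇ s)) (cong (λ z → ι z * c) unseen)
    where
    sumBelow-if : ∀ n P → sumBelow n (λ i → if P i then 0ℚ else c) ≡ ι (count n (λ i → not (P i))) * c
    sumBelow-if zero P = sym (QP.*-zeroˡ c)
    sumBelow-if (suc n) P = trans (cong₂ _+_ (sumBelow-if n P) (term (P n)))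
      (trans (sym (QP.*-distribʳ-+ c (ι (count n (λ i → not (P i)))) (ι (indicator (not (P n))))))
             (cong (_* c) (sym (ι-homo-+ (count n (λ i → not (P i))) (indicator (not (P n)))))))
      where
      term : ∀ b → (if b then 0ℚ else c) ≡ ι (indicator (not b)) * c
      term true = sym (QP.*-zeroˡ c)
      term false = sym (QP.*-identityˡ c)
    unseen : count B (λ i → not (suc i ∈ᵇ s)) ≡ B ∸ length s
    unseen = trans (sym (NP.m+n∸n≡m (count B (λ i → not (suc i ∈ᵇ s))) (count B (λ i → suc i ∈ᵇ s))))
                   (cong₂ _∸_ (count-not+count B (λ i → suc i ∈ᵇ s)) (count-∈ᵇ B s dist pos max≤B))

  -- The M ∸ length s unseen values below the maximum M of s all contribute c.
  sumBelow-unseen : ∀ N s (φ u : ℕ → ℚ) c → ValidState N s →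
    (∀ x → 1 ≤ x → x ≤ N → x ∈ᵇ s ≡ false → φ x ≡ (if listMax s <ᵇ x then u x else c)) →
    sumBelow N (λ i → if suc i ∈ᵇ s then 0ℚ else φ (suc i)) ≡
      sumBelow (N ∸ listMax s) (λ i → u (suc (listMax s ℕ.+ i))) + ι (listMax s ∸ length s) * c
  sumBelow-unseen N s φ u c (dist , pos , M≤N) φ-shape = begin
      sumBelow N f                                        ≡⟨ cong (λ z → sumBelow z f) (sym (NP.m+[n∸m]≡n M≤N)) ⟩
      sumBelow (M ℕ.+ (N ∸ M)) f                          ≡⟨ sumBelow-+ M (N ∸ M) f ⟩
      sumBelow M f + sumBelow (N ∸ M) (λ i → f (M ℕ.+ i)) ≡⟨ cong₂ _+_ below above ⟩
      ι (M ∸ length s) * c + sumBelow (N ∸ M) (λ i → u (suc (M ℕ.+ i)))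
        ≡⟨ QP.+-comm (ι (M ∸ length s) * c) _ ⟩
      sumBelow (N ∸ M) (λ i → u (suc (M ℕ.+ i))) + ι (M ∸ length s) * c ∎
    where
    open ≡-Reasoning
    M : ℕ
    M = listMax s
    f : ℕ → ℚ
    f i = if suc i ∈ᵇ s then 0ℚ else φ (suc i)
    f-below : ∀ i → i < M → f i ≡ (if suc i ∈ᵇ s then 0ℚ else c)
    f-below i i<M with suc i ∈ᵇ s in i∉s
    ... | true = refl
    ... | false = trans (φ-shape (suc i) (s≤s z≤n) (NP.≤-trans i<M M≤N) i∉s) (if-false (u (suc i)) c (≥⇒<ᵇ-false M (suc i) i<M))
    below : sumBelow M f ≡ ι (M ∸ length s) * c
    below = trans (sumBelow-cong M f-below) (sumBelow-unseen-const M s dist pos NP.≤-refl c)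
    f-above : ∀ i → i < N ∸ M → f (M ℕ.+ i) ≡ u (suc (M ℕ.+ i))
    f-above i i<N∸M = trans (if-false 0ℚ _ x∉s) (trans (φ-shape x (s≤s z≤n) x≤N x∉s) (if-true _ c (<⇒<ᵇ-true M x M<x)))
      where
      x : ℕ
      x = suc (M ℕ.+ i)
      M<x : M < x
      M<x = s≤s (NP.m≤m+n M i)
      x∉s : x ∈ᵇ s ≡ false
      x∉s = listMax<⇒∉ᵇ s x M<x
      x≤N : x ≤ N
      x≤N = subst (x ≤_) (NP.m+[n∸m]≡n M≤N) (subst (_≤ M ℕ.+ (N ∸ M)) (NP.+-suc M i) (NP.+-monoʳ-≤ M i<N∸M))
    above : sumBelow (N ∸ M) (λ i → f (M ℕ.+ i)) ≡ sumBelow (N ∸ M) (λ i → u (suc (M ℕ.+ i)))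
    above = sumBelow-cong (N ∸ M) f-above

  -- Permutations as injective words

  letter : ∀ {m} → Fin m → ℕ
  letter i = suc (toℕ i)

  vecWord : ∀ {m n} → Vec (Fin m) n → List ℕ
  vecWord v = map letter (Vec.toList v)

  uniqueᵇ : ∀ {m} → List (Fin m) → Bool
  uniqueᵇ l = does (UDec.unique? FinP._≟_ l)

  distinctᵇ : List ℕ → Bool
  distinctᵇ [] = true
  distinctᵇ (x ∷ l) = not (x ∈ᵇ l) ∧ distinctᵇ l

  does-≟≡toℕ-≡ᵇ : ∀ {m} (x y : Fin m) → does (x FinP.≟ y) ≡ (toℕ x ≡ᵇ toℕ y)
  does-≟≡toℕ-≡ᵇ fz fz = refl
  does-≟≡toℕ-≡ᵇ fz (fs y) = refl
  does-≟≡toℕ-≡ᵇ (fs x) fz = refl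
  does-≟≡toℕ-≡ᵇ (fs x) (fs y) = does-≟≡toℕ-≡ᵇ x y

  all≢≡not-∈ᵇ : ∀ {m} (x : Fin m) l → does (All.all? (λ y → ¬? (x FinP.≟ y)) l) ≡ not (letter x ∈ᵇ map letter l)
  all≢≡not-∈ᵇ x [] = refl
  all≢≡not-∈ᵇ x (y ∷ l) = trans (cong₂ (λ a b → not a ∧ b) (does-≟≡toℕ-≡ᵇ x y) (all≢≡not-∈ᵇ x l))
                                (sym (not-∨ (letter x ≡ᵇ letter y) _))
    where
    not-∨ : ∀ a b → not (a ∨ b) ≡ not a ∧ not b
    not-∨ true b = refl
    not-∨ false b = refl

  uniqueᵇ≡distinctᵇ : ∀ {m} (l : List (Fin m)) → uniqueᵇ l ≡ distinctᵇ (map letter l)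
  uniqueᵇ≡distinctᵇ [] = refl
  uniqueᵇ≡distinctᵇ (x ∷ l) = cong₂ _∧_ (all≢≡not-∈ᵇ x l) (uniqueᵇ≡distinctᵇ l)

  ∈ᵇ-++ : ∀ x a b → x ∈ᵇ (a ++ b) ≡ (x ∈ᵇ a) ∨ (x ∈ᵇ b)
  ∈ᵇ-++ x [] b = refl
  ∈ᵇ-++ x (y ∷ a) b = trans (cong ((x ≡ᵇ y) ∨_) (∈ᵇ-++ x a b)) (sym (BP.∨-assoc (x ≡ᵇ y) _ _))

  ∈ᵇ-reverse : ∀ x l → x ∈ᵇ reverse l ≡ x ∈ᵇ l
  ∈ᵇ-reverse x [] = refl
  ∈ᵇ-reverse x (y ∷ l) = trans (cong (x ∈ᵇ_) (LP.unfold-reverse y l)) (trans (∈ᵇ-++ x (reverse l) (y ∷ []))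
    (trans (cong₂ _∨_ (∈ᵇ-reverse x l) (BP.∨-identityʳ (x ≡ᵇ y))) (BP.∨-comm (x ∈ᵇ l) (x ≡ᵇ y))))

  distinctᵇ-++-∷-∈ᵇ : ∀ x l r → x ∈ᵇ l ≡ true → distinctᵇ (l ++ x ∷ r) ≡ false
  distinctᵇ-++-∷-∈ᵇ x (y ∷ l) r e with x ≡ᵇ y in xy
  ... | true = cong (λ b → not b ∧ distinctᵇ (l ++ x ∷ r)) (begin
      y ∈ᵇ (l ++ x ∷ r)            ≡⟨ ∈ᵇ-++ y l (x ∷ r) ⟩
      (y ∈ᵇ l) ∨ (y ∈ᵇ (x ∷ r))    ≡⟨ cong (λ z → (y ∈ᵇ l) ∨ (z ∈ᵇ (x ∷ r))) (sym (≡ᵇ-true⇒≡ x y xy)) ⟩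
      (y ∈ᵇ l) ∨ ((x ≡ᵇ x) ∨ _)    ≡⟨ cong (λ z → (y ∈ᵇ l) ∨ (z ∨ (x ∈ᵇ r))) (≡ᵇ-refl x) ⟩
      (y ∈ᵇ l) ∨ true              ≡⟨ BP.∨-zeroʳ _ ⟩
      true ∎)
    where open ≡-Reasoning
  ... | false = trans (cong (not (y ∈ᵇ (l ++ x ∷ r)) ∧_) (distinctᵇ-++-∷-∈ᵇ x l r e)) (BP.∧-zeroʳ _)

  distinctᵇ-∷ʳ : ∀ x l → distinctᵇ l ≡ true → x ∈ᵇ l ≡ false → distinctᵇ (l ++ x ∷ []) ≡ true
  distinctᵇ-∷ʳ x [] _ _ = refl
  distinctᵇ-∷ʳ x (y ∷ l) distinct e with y ∈ᵇ l in yl | x ≡ᵇ y in xy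
  distinctᵇ-∷ʳ x (y ∷ l) () e | true | _
  distinctᵇ-∷ʳ x (y ∷ l) distinct () | false | true
  ... | false | false =
    cong₂ _∧_ (cong not (trans (∈ᵇ-++ y l (x ∷ [])) (cong₂ _∨_ yl (cong (_∨ false) (≢⇒≡ᵇ-false y x y≢x)))))
              (distinctᵇ-∷ʳ x l distinct e)
    where
    y≢x : y ≢ x
    y≢x y≡x with () ← trans (sym (≡ᵇ-refl x)) (trans (cong (x ≡ᵇ_) (sym y≡x)) xy)

  module _ {X : Set} where
    filterᵇ-concatMap : ∀ {Y : Set} (p : X → Bool) (g : Y → List X) ys →
      List.filterᵇ p (concatMap g ys) ≡ concatMap (λ y → List.filterᵇ p (g y)) ys
    filterᵇ-concatMap p g [] = refl
    filterᵇ-concatMap p g (y ∷ ys) = trans (LP.filter-++ (λ x → T? (p x)) (g y) (concatMap g ys))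
                                           (cong (List.filterᵇ p (g y) ++_) (filterᵇ-concatMap p g ys))

    filterᵇ-cong : ∀ (p q : X → Bool) xs → (∀ x → p x ≡ q x) → List.filterᵇ p xs ≡ List.filterᵇ q xs
    filterᵇ-cong p q [] eq = refl
    filterᵇ-cong p q (x ∷ xs) eq with p x | q x | eq x
    ... | true | true | _ = cong (x ∷_) (filterᵇ-cong p q xs eq)
    ... | false | false | _ = filterᵇ-cong p q xs eq

    filterᵇ-none : ∀ (p : X → Bool) xs → (∀ x → p x ≡ false) → List.filterᵇ p xs ≡ []
    filterᵇ-none p [] eq = refl
    filterᵇ-none p (x ∷ xs) eq with p x | eq x
    ... | false | _ = filterᵇ-none p xs eq

    filterᵇ-[-] : ∀ (p : X → Bool) x → p x ≡ true → List.filterᵇ p (x ∷ []) ≡ x ∷ []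
    filterᵇ-[-] p x e with p x
    filterᵇ-[-] p x refl | true = refl

  filterᵇ-map-∷ : ∀ {m n} (p : Vec (Fin m) (suc n) → Bool) (x : Fin m) L →
    List.filterᵇ p (map (x Vec.∷_) L) ≡ map (x Vec.∷_) (List.filterᵇ (λ v → p (x Vec.∷ v)) L)
  filterᵇ-map-∷ p x [] = refl
  filterᵇ-map-∷ p x (v ∷ L) with p (x Vec.∷ v)
  ... | true = cong ((x Vec.∷ v) ∷_) (filterᵇ-map-∷ p x L)
  ... | false = filterᵇ-map-∷ p x L

  tabulate-∘toℕ : ∀ n (f : ℕ → ℕ) → List.tabulate (f ∘ toℕ {n}) ≡ applyUpTo f n
  tabulate-∘toℕ zero f = refl
  tabulate-∘toℕ (suc n) f = cong (f 0 ∷_) (tabulate-∘toℕ n (f ∘ suc))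

  map-letter-allFin : ∀ m → map (letter {m}) (List.allFin m) ≡ applyUpTo suc m
  map-letter-allFin m = trans (LP.map-tabulate id letter) (tabulate-∘toℕ m suc)

  filter-unique≡injWords : ∀ m n (s : List (Fin m)) → distinctᵇ (map letter (reverse s)) ≡ true →
    map vecWord (List.filterᵇ (λ v → uniqueᵇ (reverse s ++ Vec.toList v)) (allVecs m n)) ≡ injWords m (map letter s) n
  filter-unique≡injWords m zero s distinct = cong (map vecWord) (filterᵇ-[-] (λ v → uniqueᵇ (reverse s ++ Vec.toList v)) Vec.[] (begin
      uniqueᵇ (reverse s ++ [])               ≡⟨ uniqueᵇ≡distinctᵇ (reverse s ++ []) ⟩
      distinctᵇ (map letter (reverse s ++ [])) ≡⟨ cong (λ z → distinctᵇ (map letter z)) (LP.++-identityʳ (reverse s)) ⟩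
      distinctᵇ (map letter (reverse s))      ≡⟨ distinct ⟩
      true ∎))
    where open ≡-Reasoning
  filter-unique≡injWords m (suc n) s distinct = begin
      map vecWord (List.filterᵇ p (concatMap (λ x → map (x Vec.∷_) (allVecs m n)) (List.allFin m)))
        ≡⟨ cong (map vecWord) (filterᵇ-concatMap p _ (List.allFin m)) ⟩
      map vecWord (concatMap (λ x → List.filterᵇ p (map (x Vec.∷_) (allVecs m n))) (List.allFin m))
        ≡⟨ LP.map-concatMap vecWord _ (List.allFin m) ⟩
      concatMap (λ x → map vecWord (List.filterᵇ p (map (x Vec.∷_) (allVecs m n)))) (List.allFin m)
        ≡⟨ LP.concatMap-cong first-letter (List.allFin m) ⟩
      concatMap (λ x → extend (letter x)) (List.allFin m)
        ≡⟨ sym (LP.concatMap-map extend letter (List.allFin m)) ⟩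
      concatMap extend (map letter (List.allFin m))
        ≡⟨ cong (concatMap extend) (map-letter-allFin m) ⟩
      injWords m (map letter s) (suc n) ∎
    where
    open ≡-Reasoning
    p : Vec (Fin m) (suc n) → Bool
    p v = uniqueᵇ (reverse s ++ Vec.toList v)
    extend : ℕ → List (List ℕ)
    extend y = if y ∈ᵇ map letter s then [] else map (y ∷_) (injWords m (y ∷ map letter s) n)
    ∈ᵇ-map-reverse : ∀ x → letter x ∈ᵇ map letter (reverse s) ≡ letter x ∈ᵇ map letter s
    ∈ᵇ-map-reverse x = trans (cong (letter x ∈ᵇ_) (LP.reverse-map letter s)) (∈ᵇ-reverse (letter x) (map letter s))
    first-letter : ∀ x → map vecWord (List.filterᵇ p (map (x Vec.∷_) (allVecs m n))) ≡ extend (letter x)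
    first-letter x with letter x ∈ᵇ map letter s in x∈s
    ... | true = cong (map vecWord) (trans (filterᵇ-map-∷ p x (allVecs m n))
                   (cong (map (x Vec.∷_)) (filterᵇ-none _ (allVecs m n) repeated)))
      where
      repeated : ∀ v → uniqueᵇ (reverse s ++ x ∷ Vec.toList v) ≡ false
      repeated v = trans (uniqueᵇ≡distinctᵇ (reverse s ++ x ∷ Vec.toList v))
        (trans (cong distinctᵇ (LP.map-++ letter (reverse s) (x ∷ Vec.toList v)))
               (distinctᵇ-++-∷-∈ᵇ (letter x) (map letter (reverse s)) _ (trans (∈ᵇ-map-reverse x) x∈s)))
    ... | false = begin
          map vecWord (List.filterᵇ p (map (x Vec.∷_) (allVecs m n)))
            ≡⟨ cong (map vecWord) (filterᵇ-map-∷ p x (allVecs m n)) ⟩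
          map vecWord (map (x Vec.∷_) (List.filterᵇ (λ v → p (x Vec.∷ v)) (allVecs m n)))
            ≡⟨ trans (sym (LP.map-∘ (List.filterᵇ (λ v → p (x Vec.∷ v)) (allVecs m n)))) (LP.map-∘ _) ⟩
          map (letter x ∷_) (map vecWord (List.filterᵇ (λ v → p (x Vec.∷ v)) (allVecs m n)))
            ≡⟨ cong (λ z → map (letter x ∷_) (map vecWord z))
                    (filterᵇ-cong _ _ (allVecs m n) (λ v → cong uniqueᵇ (sym (reverse-∷-++ x s (Vec.toList v))))) ⟩
          map (letter x ∷_) (map vecWord (List.filterᵇ (λ v → uniqueᵇ (reverse (x ∷ s) ++ Vec.toList v)) (allVecs m n)))
            ≡⟨ cong (map (letter x ∷_)) (filter-unique≡injWords m n (x ∷ s) distinct′) ⟩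
          map (letter x ∷_) (injWords m (letter x ∷ map letter s) n) ∎
      where
      distinct′ : distinctᵇ (map letter (reverse (x ∷ s))) ≡ true
      distinct′ = trans (cong (λ z → distinctᵇ (map letter z)) (LP.unfold-reverse x s))
        (trans (cong distinctᵇ (LP.map-++ letter (reverse s) (x ∷ [])))
               (distinctᵇ-∷ʳ (letter x) (map letter (reverse s)) distinct (trans (∈ᵇ-map-reverse x) x∈s)))

  perms≡injWords : ∀ N → perms N ≡ injWords N [] N
  perms≡injWords N = filter-unique≡injWords N N [] refl

  -- Subsets with a given maximum, and harmonic numbers

  -- The number of j-element subsets of {1, ..., M} with maximum M, i.e. C(M-1, j-1) for j ≥ 1.
  subsetsWithMax : ℕ → ℕ → ℕ
  subsetsWithMax zero zero = 1
  subsetsWithMax zero (suc M) = 0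
  subsetsWithMax (suc j) M = sumBelowℕ M (subsetsWithMax j)

  subsetsWithMax-< : ∀ j M → M < j → subsetsWithMax j M ≡ 0
  subsetsWithMax-< (suc j) M M<j =
    trans (sumBelowℕ-cong M (λ i i<M → subsetsWithMax-< j i (NP.<-≤-trans i<M (NP.≤-pred M<j)))) (sumBelowℕ-zero M)

  subsetsWithMax-diag : ∀ j → subsetsWithMax j j ≡ 1
  subsetsWithMax-diag zero = refl
  subsetsWithMax-diag (suc j) = cong₂ ℕ._+_ (subsetsWithMax-< (suc j) j (NP.n<1+n j)) (subsetsWithMax-diag j)

  [M∸i+i]*subsetsWithMax : ∀ i j M → i ≤ j → (M ∸ i ℕ.+ i) ℕ.* subsetsWithMax j M ≡ M ℕ.* subsetsWithMax j M
  [M∸i+i]*subsetsWithMax i j M i≤j with i ℕ.≤? M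
  ... | yes i≤M = cong (ℕ._* subsetsWithMax j M) (NP.m∸n+n≡m i≤M)
  ... | no i≰M rewrite subsetsWithMax-< j M (NP.<-≤-trans (NP.≰⇒> i≰M) i≤j) = trans (NP.*-zeroʳ (M ∸ i ℕ.+ i)) (sym (NP.*-zeroʳ M))

  subsetsWithMax-absorb : ∀ j M → (M ∸ j) ℕ.* subsetsWithMax j M ≡ j ℕ.* subsetsWithMax (suc j) M
  subsetsWithMax-absorb j zero = trans (cong (ℕ._* subsetsWithMax j 0) (NP.0∸n≡0 j)) (sym (NP.*-zeroʳ j))
  subsetsWithMax-absorb zero (suc M) = NP.*-zeroʳ (suc M)
  subsetsWithMax-absorb (suc j) (suc M) = begin
      (M ∸ j) ℕ.* (E′ ℕ.+ subsetsWithMax j M)             ≡⟨ NP.*-distribˡ-+ (M ∸ j) E′ (subsetsWithMax j M) ⟩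
      (M ∸ j) ℕ.* E′ ℕ.+ (M ∸ j) ℕ.* subsetsWithMax j M  ≡⟨ cong ((M ∸ j) ℕ.* E′ ℕ.+_) (subsetsWithMax-absorb j M) ⟩
      (M ∸ j) ℕ.* E′ ℕ.+ j ℕ.* E′                         ≡⟨ sym (NP.*-distribʳ-+ E′ (M ∸ j) j) ⟩
      (M ∸ j ℕ.+ j) ℕ.* E′                                ≡⟨ [M∸i+i]*subsetsWithMax j (suc j) M (NP.n≤1+n j) ⟩
      M ℕ.* E′                                            ≡⟨ sym ([M∸i+i]*subsetsWithMax (suc j) (suc j) M NP.≤-refl) ⟩
      (M ∸ suc j ℕ.+ suc j) ℕ.* E′                        ≡⟨ NP.*-distribʳ-+ E′ (M ∸ suc j) (suc j) ⟩
      (M ∸ suc j) ℕ.* E′ ℕ.+ suc j ℕ.* E′                 ≡⟨ cong (ℕ._+ suc j ℕ.* E′) (subsetsWithMax-absorb (suc j) M) ⟩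
      suc j ℕ.* E″ ℕ.+ suc j ℕ.* E′                       ≡⟨ sym (NP.*-distribˡ-+ (suc j) E″ E′) ⟩
      suc j ℕ.* (E″ ℕ.+ E′) ∎
    where
    open ≡-Reasoning
    E′ : ℕ
    E′ = subsetsWithMax (suc j) M
    E″ : ℕ
    E″ = subsetsWithMax (suc (suc j)) M

  subsetsWithMax-shift : ∀ k m →
    suc k ℕ.* subsetsWithMax (suc (suc k)) (suc (suc m)) ≡ suc m ℕ.* subsetsWithMax (suc k) (suc m)
  subsetsWithMax-shift k m = begin
      suc k ℕ.* (E″ ℕ.+ E′)              ≡⟨ NP.*-distribˡ-+ (suc k) E″ E′ ⟩
      suc k ℕ.* E″ ℕ.+ suc k ℕ.* E′      ≡⟨ cong (ℕ._+ suc k ℕ.* E′) (sym (subsetsWithMax-absorb (suc k) (suc m))) ⟩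
      (m ∸ k) ℕ.* E′ ℕ.+ suc k ℕ.* E′    ≡⟨ sym (NP.*-distribʳ-+ E′ (m ∸ k) (suc k)) ⟩
      (m ∸ k ℕ.+ suc k) ℕ.* E′           ≡⟨ [M∸i+i]*subsetsWithMax (suc k) (suc k) (suc m) NP.≤-refl ⟩
      suc m ℕ.* E′ ∎
    where
    open ≡-Reasoning
    E′ : ℕ
    E′ = subsetsWithMax (suc k) (suc m)
    E″ : ℕ
    E″ = subsetsWithMax (suc (suc k)) (suc m)

  subsetsWithMax-1 : ∀ m → subsetsWithMax 1 (suc m) ≡ 1
  subsetsWithMax-1 zero = refl
  subsetsWithMax-1 (suc m) = cong (ℕ._+ 0) (subsetsWithMax-1 m)

  sumBelow-subsetsWithMax₀ : ∀ m (h : ℕ → ℚ) → sumBelow (suc m) (λ M → ι (subsetsWithMax 0 M) * h M) ≡ h 0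
  sumBelow-subsetsWithMax₀ m h = trans (sumBelow-head m _)
    (trans (cong₂ _+_ (QP.*-identityˡ (h 0)) (sumBelow-zero m _ (λ i _ → QP.*-zeroˡ (h (suc i))))) (QP.+-identityʳ (h 0)))

  harmonic : ℕ → ℚ
  harmonic zero = 0ℚ
  harmonic (suc d) = harmonic d + 1/suc d

  weightedHarmonic : ℕ → ℕ → ℚ
  weightedHarmonic k m = sumBelow (suc m) (λ M → ι (subsetsWithMax k M) * harmonic (m ∸ M))

  weightedHarmonic-unfold : ∀ k N m → N ≡ suc m →
    sumBelow N (λ M → ι (subsetsWithMax k M) * harmonic (N ∸ suc M)) ≡ weightedHarmonic k m
  weightedHarmonic-unfold k N m refl = refl

  weightedHarmonic-closed : ∀ k m → weightedHarmonic k m ≡ ι (subsetsWithMax (suc k) (suc m)) * (harmonic m - harmonic k)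
  weightedHarmonic-closed zero m = begin
      weightedHarmonic 0 m                                 ≡⟨ sumBelow-subsetsWithMax₀ m (λ M → harmonic (m ∸ M)) ⟩
      harmonic m                                           ≡⟨ solve 1 (λ h → h := con 1ℚ :* (h :- con 0ℚ)) refl (harmonic m) ⟩
      1ℚ * (harmonic m - 0ℚ)                               ≡⟨ cong (λ z → ι z * (harmonic m - 0ℚ)) (sym (subsetsWithMax-1 m)) ⟩
      ι (subsetsWithMax 1 (suc m)) * (harmonic m - 0ℚ) ∎
    where open ≡-Reasoning
  weightedHarmonic-closed (suc k) zero = sym (QP.*-zeroˡ (harmonic 0 - harmonic (suc k)))
  weightedHarmonic-closed (suc k) (suc m) = begin
      weightedHarmonic (suc k) (suc m)
        ≡⟨ sumBelow-head (suc m) _ ⟩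
      0ℚ * harmonic (suc m) + sumBelow (suc m) (λ i → ι (subsetsWithMax (suc k) (suc i)) * harmonic (m ∸ i))
        ≡⟨ trans (cong (_+ tail) (QP.*-zeroˡ (harmonic (suc m)))) (trans (QP.+-identityˡ tail) (sumBelow-cong (suc m) (λ i _ → split i))) ⟩
      sumBelow (suc m) (λ i → ι (subsetsWithMax (suc k) i) * harmonic (m ∸ i) + ι (subsetsWithMax k i) * harmonic (m ∸ i))
        ≡⟨ sumBelow-distrib-+ (suc m) _ _ ⟩
      weightedHarmonic (suc k) m + weightedHarmonic k m
        ≡⟨ cong₂ _+_ (weightedHarmonic-closed (suc k) m) (weightedHarmonic-closed k m) ⟩
      a * (harmonic m - (harmonic k + 1/suc k)) + b * (harmonic m - harmonic k)
        ≡⟨ telescope a b (harmonic m) (harmonic k) (1/suc m) (1/suc k) shift ⟩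
      (a + b) * ((harmonic m + 1/suc m) - (harmonic k + 1/suc k))
        ≡⟨ cong (_* ((harmonic m + 1/suc m) - (harmonic k + 1/suc k))) (sym (ι-homo-+ A B)) ⟩
      ι (subsetsWithMax (suc (suc k)) (suc (suc m))) * (harmonic (suc m) - harmonic (suc k)) ∎
    where
    open ≡-Reasoning
    A : ℕ
    A = subsetsWithMax (suc (suc k)) (suc m)
    B : ℕ
    B = subsetsWithMax (suc k) (suc m)
    a : ℚ
    a = ι A
    b : ℚ
    b = ι B
    tail : ℚ
    tail = sumBelow (suc m) (λ i → ι (subsetsWithMax (suc k) (suc i)) * harmonic (m ∸ i))
    split : ∀ i → ι (subsetsWithMax (suc k) (suc i)) * harmonic (m ∸ i)
                ≡ ι (subsetsWithMax (suc k) i) * harmonic (m ∸ i) + ι (subsetsWithMax k i) * harmonic (m ∸ i)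
    split i = trans (cong (_* harmonic (m ∸ i)) (ι-homo-+ (subsetsWithMax (suc k) i) (subsetsWithMax k i)))
                    (QP.*-distribʳ-+ (harmonic (m ∸ i)) (ι (subsetsWithMax (suc k) i)) (ι (subsetsWithMax k i)))
    shift : (a + b) * 1/suc m ≡ b * 1/suc k
    shift = cross-multiply (a + b) b k m (begin
        (a + b) * ι (suc k)                                ≡⟨ QP.*-comm (a + b) (ι (suc k)) ⟩
        ι (suc k) * (a + b)                                ≡⟨ cong (ι (suc k) *_) (sym (ι-homo-+ A B)) ⟩
        ι (suc k) * ι (A ℕ.+ B)                            ≡⟨ sym (ι-homo-* (suc k) (A ℕ.+ B)) ⟩
        ι (suc k ℕ.* (A ℕ.+ B))                            ≡⟨ cong ι (subsetsWithMax-shift k m) ⟩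
        ι (suc m ℕ.* B)                                    ≡⟨ trans (ι-homo-* (suc m) B) (QP.*-comm (ι (suc m)) b) ⟩
        b * ι (suc m) ∎)
    telescope : ∀ a b hm hk im ik → (a + b) * im ≡ b * ik →
      a * (hm - (hk + ik)) + b * (hm - hk) ≡ (a + b) * ((hm + im) - (hk + ik))
    telescope a b hm hk im ik e = begin
        a * (hm - (hk + ik)) + b * (hm - hk)
          ≡⟨ solve 6 (λ a b hm hk im ik → a :* (hm :- (hk :+ ik)) :+ b :* (hm :- hk)
                                        := (a :+ b) :* ((hm :+ im) :- (hk :+ ik)) :+ (b :* ik :- (a :+ b) :* im))
                     refl a b hm hk im ik ⟩
        (a + b) * ((hm + im) - (hk + ik)) + (b * ik - (a + b) * im)
          ≡⟨ cong (λ z → (a + b) * ((hm + im) - (hk + ik)) + (b * ik - z)) e ⟩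
        (a + b) * ((hm + im) - (hk + ik)) + (b * ik - b * ik)
          ≡⟨ solve 2 (λ x y → x :+ (y :- y) := x) refl ((a + b) * ((hm + im) - (hk + ik))) (b * ik) ⟩
        (a + b) * ((hm + im) - (hk + ik)) ∎

  sumBelow-1/suc : ∀ k d → sumBelow d (λ t → 1/suc (k ℕ.+ t)) ≡ harmonic (k ℕ.+ d) - harmonic k
  sumBelow-1/suc k zero =
    trans (sym (QP.+-inverseʳ (harmonic k))) (cong (λ z → harmonic z - harmonic k) (sym (NP.+-identityʳ k)))
  sumBelow-1/suc k (suc d) = trans (cong (_+ 1/suc (k ℕ.+ d)) (sumBelow-1/suc k d))
    (trans (solve 3 (λ x y z → (x :- y) :+ z := (x :+ z) :- y) refl (harmonic (k ℕ.+ d)) (harmonic k) (1/suc (k ℕ.+ d)))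
           (cong (λ z → harmonic z - harmonic k) (sym (NP.+-suc k d))))

  product-range≡!*subsetsWithMax : ∀ k d →
    foldr ℕ._*_ 1 (applyUpTo (λ t → suc k ℕ.+ t) d) ≡ d ! ℕ.* subsetsWithMax (suc k) (suc (k ℕ.+ d))
  product-range≡!*subsetsWithMax k zero = sym (trans (NP.+-identityʳ _)
    (trans (cong (λ z → subsetsWithMax (suc k) (suc z)) (NP.+-identityʳ k)) (subsetsWithMax-diag (suc k))))
  product-range≡!*subsetsWithMax k (suc d) = begin
      (suc k ℕ.+ 0) ℕ.* foldr ℕ._*_ 1 (applyUpTo (λ t → suc k ℕ.+ suc t) d)
        ≡⟨ cong₂ ℕ._*_ (NP.+-identityʳ (suc k)) (cong (foldr ℕ._*_ 1) (applyUpTo-cong _ _ d (NP.+-suc (suc k)))) ⟩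
      suc k ℕ.* foldr ℕ._*_ 1 (applyUpTo (λ t → suc (suc k) ℕ.+ t) d)
        ≡⟨ cong (suc k ℕ.*_) (product-range≡!*subsetsWithMax (suc k) d) ⟩
      suc k ℕ.* (d ! ℕ.* E2)
        ≡⟨ ℕsolve 3 (λ a b c → a :*ℕ (b :*ℕ c) :=ℕ b :*ℕ (a :*ℕ c)) refl (suc k) (d !) E2 ⟩
      d ! ℕ.* (suc k ℕ.* E2)
        ≡⟨ cong (d ! ℕ.*_) (sym (subsetsWithMax-absorb (suc k) X)) ⟩
      d ! ℕ.* ((X ∸ suc k) ℕ.* E1)
        ≡⟨ cong (λ z → d ! ℕ.* (z ℕ.* E1)) X∸1+k ⟩
      d ! ℕ.* (suc d ℕ.* E1)
        ≡⟨ ℕsolve 3 (λ a b c → a :*ℕ (b :*ℕ c) :=ℕ (b :*ℕ a) :*ℕ c) refl (d !) (suc d) E1 ⟩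
      suc d ! ℕ.* E1
        ≡⟨ cong (λ z → suc d ! ℕ.* subsetsWithMax (suc k) (suc z)) (sym (NP.+-suc k d)) ⟩
      suc d ! ℕ.* subsetsWithMax (suc k) (suc (k ℕ.+ suc d)) ∎
    where
    open ≡-Reasoning
    X : ℕ
    X = suc (suc (k ℕ.+ d))
    E1 : ℕ
    E1 = subsetsWithMax (suc k) X
    E2 : ℕ
    E2 = subsetsWithMax (suc (suc k)) X
    X∸1+k : X ∸ suc k ≡ suc d
    X∸1+k = trans (cong (_∸ k) (sym (NP.+-suc k d))) (NP.m+n∸m≡n k (suc d))

  -- Weights of winnable completions and of prefixes

  listMax-reverse-++[] : ∀ p → listMax (reverse p ++ []) ≡ listMax p
  listMax-reverse-++[] p = trans (cong listMax (LP.++-identityʳ (reverse p))) (listMax-reverse p)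

  length-reverse-++[] : ∀ (p : List ℕ) → length (reverse p ++ []) ≡ length p
  length-reverse-++[] p = trans (cong length (LP.++-identityʳ (reverse p))) (LP.length-reverse p)

  lrmAux-++ : ∀ s p w → lrmAux s (p ++ w) ≡ lrmAux s p ℕ.+ lrmAux (reverse p ++ s) w
  lrmAux-++ s [] w = refl
  lrmAux-++ s (x ∷ p) w = begin
      r ℕ.+ lrmAux (x ∷ s) (p ++ w)
        ≡⟨ cong (r ℕ.+_) (lrmAux-++ (x ∷ s) p w) ⟩
      r ℕ.+ (lrmAux (x ∷ s) p ℕ.+ lrmAux (reverse p ++ x ∷ s) w)
        ≡⟨ sym (NP.+-assoc r (lrmAux (x ∷ s) p) _) ⟩
      r ℕ.+ lrmAux (x ∷ s) p ℕ.+ lrmAux (reverse p ++ x ∷ s) w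
        ≡⟨ cong (λ t → r ℕ.+ lrmAux (x ∷ s) p ℕ.+ lrmAux t w) (sym (reverse-∷-++ x p s)) ⟩
      r ℕ.+ lrmAux (x ∷ s) p ℕ.+ lrmAux (reverse (x ∷ p) ++ s) w ∎
    where
    open ≡-Reasoning
    r : ℕ
    r = if exceedsAll s x then 1 else 0

  hits : ℕ → Maybe ℕ → Bool
  hits N (just x) = does (x ℕ.≟ N)
  hits N nothing = false

  module Weights (N : ℕ) (θ : ℚ) where

    winWeight : ℕ → List ℕ → List ℕ → ℚ
    winWeight j s w = if hits N (selectAux j s w) then θ ^ℚ lrmAux s w else 0ℚ

    recordFactor : List ℕ → ℕ → ℚ
    recordFactor s x = if exceedsAll s x then θ else 1ℚ

    ^ℚ-lrmAux-∷ : ∀ s x w → θ ^ℚ lrmAux s (x ∷ w) ≡ recordFactor s x * θ ^ℚ lrmAux (x ∷ s) w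
    ^ℚ-lrmAux-∷ s x w with exceedsAll s x
    ... | true = refl
    ... | false = sym (QP.*-identityˡ _)

    winWeight-reject : ∀ j s x w → winWeight (suc j) s (x ∷ w) ≡ recordFactor s x * winWeight j (x ∷ s) w
    winWeight-reject j s x w with hits N (selectAux j (x ∷ s) w)
    ... | true = ^ℚ-lrmAux-∷ s x w
    ... | false = sym (QP.*-zeroʳ (recordFactor s x))

    winWeight-pass : ∀ s x w → exceedsAll s x ≡ false → winWeight 0 s (x ∷ w) ≡ winWeight 0 (x ∷ s) w
    winWeight-pass s x w not-record rewrite not-record = refl

    winWeight-accept : ∀ s x w → exceedsAll s x ≡ true →
      winWeight 0 s (x ∷ w) ≡ (if x ≡ᵇ N then θ * θ ^ℚ lrmAux (x ∷ s) w else 0ℚ)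
    winWeight-accept s x w is-record rewrite is-record = refl

    sum-^lrm-maxSeen : ∀ n s → ValidState N s → listMax s ≡ N → n ℕ.+ length s ≡ N →
      sumOver (injWords N s n) (λ w → θ ^ℚ lrmAux s w) ≡ ι (n !)
    sum-^lrm-maxSeen zero s _ _ _ = QP.+-identityʳ 1ℚ
    sum-^lrm-maxSeen (suc n) s valid max≡N size = begin
        sumOver (injWords N s (suc n)) (λ w → θ ^ℚ lrmAux s w)
          ≡⟨ sum-injWords-suc N s n _ ⟩
        sumBelow N (λ i → if suc i ∈ᵇ s then 0ℚ else φ (suc i))
          ≡⟨ sumBelow-unseen N s φ (λ _ → 0ℚ) (ι (n !)) valid first-letter ⟩
        sumBelow (N ∸ listMax s) (λ _ → 0ℚ) + ι (listMax s ∸ length s) * ι (n !)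
          ≡⟨ cong₂ (λ a b → sumBelow a (λ _ → 0ℚ) + ι b * ι (n !)) none-above unseen-below ⟩
        0ℚ + ι (suc n) * ι (n !)
          ≡⟨ trans (QP.+-identityˡ _) (sym (ι-homo-* (suc n) (n !))) ⟩
        ι (suc n !) ∎
      where
      open ≡-Reasoning
      none-above : N ∸ listMax s ≡ 0
      none-above = trans (cong (N ∸_) max≡N) (NP.n∸n≡0 N)
      unseen-below : listMax s ∸ length s ≡ suc n
      unseen-below = trans (cong (_∸ length s) (trans max≡N (sym size))) (NP.m+n∸n≡m (suc n) (length s))
      φ : ℕ → ℚ
      φ x = sumOver (injWords N (x ∷ s) n) (λ w → θ ^ℚ lrmAux s (x ∷ w))
      first-letter : ∀ x → 1 ≤ x → x ≤ N → x ∈ᵇ s ≡ false → φ x ≡ (if listMax s <ᵇ x then 0ℚ else ι (n !))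
      first-letter x 1≤x x≤N x∉s = begin
          φ x                                                    ≡⟨ sumOver-cong (injWords N (x ∷ s) n) no-record ⟩
          sumOver (injWords N (x ∷ s) n) (λ w → θ ^ℚ lrmAux (x ∷ s) w)
            ≡⟨ sum-^lrm-maxSeen n (x ∷ s) (ValidState-∷ valid 1≤x x≤N x∉s)
                 (trans (cong (x ⊔_) max≡N) (NP.m≤n⇒m⊔n≡n x≤N)) (trans (NP.+-suc n (length s)) size) ⟩
          ι (n !)                                                ≡⟨ sym (if-false 0ℚ (ι (n !)) x≤max) ⟩
          (if listMax s <ᵇ x then 0ℚ else ι (n !)) ∎
        where
        x≤max : (listMax s <ᵇ x) ≡ false
        x≤max = ≥⇒<ᵇ-false (listMax s) x (subst (x ≤_) (sym max≡N) x≤N)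
        no-record : ∀ w → θ ^ℚ lrmAux s (x ∷ w) ≡ θ ^ℚ lrmAux (x ∷ s) w
        no-record w with exceedsAll s x | exceedsAll≡listMax<ᵇ s x 1≤x
        ... | false | _ = refl
        ... | true | x>max = ⊥-elim (subst T (trans x>max x≤max) tt)

    -- With a values above the current maximum and n entries left, accepting the next record wins with weight θ · n! / a.
    acceptWeight : ℕ → ℕ → ℚ
    acceptWeight n zero = 0ℚ
    acceptWeight n (suc a) = θ * ι (n !) * 1/suc a

    firstRecordWeight : ℕ → ℕ → ℚ
    firstRecordWeight n x = if x ≡ᵇ N then θ * ι (n !) else 0ℚ

    sumBelow-firstRecordWeight : ∀ n M a → M ℕ.+ suc a ≡ N →
      sumBelow (suc a) (λ i → firstRecordWeight n (suc (M ℕ.+ i))) ≡ θ * ι (n !)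
    sumBelow-firstRecordWeight n M a M+a+1≡N = begin
        sumBelow a (λ i → firstRecordWeight n (suc (M ℕ.+ i))) + firstRecordWeight n (suc (M ℕ.+ a))
          ≡⟨ cong₂ _+_ (sumBelow-zero a _ below-N) (if-true _ 0ℚ (≡⇒≡ᵇ-true (trans (sym (NP.+-suc M a)) M+a+1≡N))) ⟩
        0ℚ + θ * ι (n !)
          ≡⟨ QP.+-identityˡ _ ⟩
        θ * ι (n !) ∎
      where
      open ≡-Reasoning
      below-N : ∀ i → i < a → firstRecordWeight n (suc (M ℕ.+ i)) ≡ 0ℚ
      below-N i i<a = if-false _ 0ℚ (≢⇒≡ᵇ-false _ N (NP.<⇒≢ (subst (suc (M ℕ.+ i) <_) (trans (sym (NP.+-suc M a)) M+a+1≡N)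
                                                               (s≤s (NP.+-monoʳ-< M i<a)))))

    acceptWeight-step : ∀ n M ℓ a → ℓ ≤ M → M ℕ.+ a ≡ N → suc n ℕ.+ ℓ ≡ N →
      sumBelow a (λ i → firstRecordWeight n (suc (M ℕ.+ i))) + ι (M ∸ ℓ) * acceptWeight n a ≡ acceptWeight (suc n) a
    acceptWeight-step n M ℓ zero ℓ≤M _ _ = trans (QP.+-identityˡ _) (QP.*-zeroʳ (ι (M ∸ ℓ)))
    acceptWeight-step n M ℓ (suc a) ℓ≤M M+a≡N size = begin
        sumBelow (suc a) (λ i → firstRecordWeight n (suc (M ℕ.+ i))) + ι (M ∸ ℓ) * acceptWeight n (suc a)
          ≡⟨ cong (_+ ι (M ∸ ℓ) * acceptWeight n (suc a)) (sumBelow-firstRecordWeight n M a M+a≡N) ⟩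
        θ * ι (n !) + ι (M ∸ ℓ) * (θ * ι (n !) * 1/suc a)
          ≡⟨ cong (λ z → z + ι (M ∸ ℓ) * (θ * ι (n !) * 1/suc a))
                  (sym (trans (cong (θ * ι (n !) *_) (ι-suc*1/suc≡1 a)) (QP.*-identityʳ (θ * ι (n !))))) ⟩
        θ * ι (n !) * (ι (suc a) * 1/suc a) + ι (M ∸ ℓ) * (θ * ι (n !) * 1/suc a)
          ≡⟨ solve 5 (λ t f p q v → t :* f :* (q :* v) :+ p :* (t :* f :* v) := t :* ((p :+ q) :* f) :* v)
                     refl θ (ι (n !)) (ι (M ∸ ℓ)) (ι (suc a)) (1/suc a) ⟩
        θ * ((ι (M ∸ ℓ) + ι (suc a)) * ι (n !)) * 1/suc a
          ≡⟨ cong (λ z → θ * z * 1/suc a) (trans (cong (_* ι (n !)) (trans (sym (ι-homo-+ (M ∸ ℓ) (suc a))) (cong ι unseen)))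
                                                  (sym (ι-homo-* (suc n) (n !)))) ⟩
        acceptWeight (suc n) (suc a) ∎
      where
      open ≡-Reasoning
      unseen : M ∸ ℓ ℕ.+ suc a ≡ suc n
      unseen = NP.+-cancelʳ-≡ ℓ _ _ (begin
        M ∸ ℓ ℕ.+ suc a ℕ.+ ℓ   ≡⟨ NP.+-assoc (M ∸ ℓ) (suc a) ℓ ⟩
        M ∸ ℓ ℕ.+ (suc a ℕ.+ ℓ) ≡⟨ cong (M ∸ ℓ ℕ.+_) (NP.+-comm (suc a) ℓ) ⟩
        M ∸ ℓ ℕ.+ (ℓ ℕ.+ suc a) ≡⟨ sym (NP.+-assoc (M ∸ ℓ) ℓ (suc a)) ⟩
        M ∸ ℓ ℕ.+ ℓ ℕ.+ suc a   ≡⟨ cong (ℕ._+ suc a) (NP.m∸n+n≡m ℓ≤M) ⟩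
        M ℕ.+ suc a             ≡⟨ trans M+a≡N (sym size) ⟩
        suc n ℕ.+ ℓ ∎)

    sum-winWeight₀ : ∀ n s → ValidState N s → n ℕ.+ length s ≡ N →
      sumOver (injWords N s n) (winWeight 0 s) ≡ acceptWeight n (N ∸ listMax s)
    sum-winWeight₀ zero s (dist , pos , _) size =
      sym (cong (acceptWeight 0) (NP.m≤n⇒m∸n≡0 (subst (_≤ listMax s) size (length≤listMax s dist pos))))
    sum-winWeight₀ (suc n) s valid@(dist , pos , max≤N) size = begin
        sumOver (injWords N s (suc n)) (winWeight 0 s)
          ≡⟨ sum-injWords-suc N s n _ ⟩
        sumBelow N (λ i → if suc i ∈ᵇ s then 0ℚ else φ (suc i))
          ≡⟨ sumBelow-unseen N s φ (firstRecordWeight n) (acceptWeight n (N ∸ M)) valid first-letter ⟩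
        sumBelow (N ∸ M) (λ i → firstRecordWeight n (suc (M ℕ.+ i))) + ι (M ∸ length s) * acceptWeight n (N ∸ M)
          ≡⟨ acceptWeight-step n M (length s) (N ∸ M) (length≤listMax s dist pos) (NP.m+[n∸m]≡n max≤N) size ⟩
        acceptWeight (suc n) (N ∸ M) ∎
      where
      open ≡-Reasoning
      M : ℕ
      M = listMax s
      φ : ℕ → ℚ
      φ x = sumOver (injWords N (x ∷ s) n) (λ w → winWeight 0 s (x ∷ w))
      size′ : n ℕ.+ suc (length s) ≡ N
      size′ = trans (NP.+-suc n (length s)) size
      first-letter : ∀ x → 1 ≤ x → x ≤ N → x ∈ᵇ s ≡ false →
        φ x ≡ (if M <ᵇ x then firstRecordWeight n x else acceptWeight n (N ∸ M))
      first-letter x 1≤x x≤N x∉s with M <ᵇ x in x>M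
      ... | true = begin
            φ x
              ≡⟨ sumOver-cong (injWords N (x ∷ s) n) (λ w → winWeight-accept s x w (trans (exceedsAll≡listMax<ᵇ s x 1≤x) x>M)) ⟩
            sumOver (injWords N (x ∷ s) n) (λ w → if x ≡ᵇ N then θ * θ ^ℚ lrmAux (x ∷ s) w else 0ℚ)
              ≡⟨ sumOver-if (x ≡ᵇ N) (≡ᵇ-true⇒≡ x N) ⟩
            firstRecordWeight n x ∎
        where
        sumOver-if : ∀ b → (b ≡ true → x ≡ N) →
                     sumOver (injWords N (x ∷ s) n) (λ w → if b then θ * θ ^ℚ lrmAux (x ∷ s) w else 0ℚ)
                         ≡ (if b then θ * ι (n !) else 0ℚ)
        sumOver-if false _ = sumOver-zero (injWords N (x ∷ s) n)
        sumOver-if true x≡N = trans (sumOver-scale (injWords N (x ∷ s) n) θ _) (cong (θ *_)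
          (sum-^lrm-maxSeen n (x ∷ s) (ValidState-∷ valid 1≤x x≤N x∉s)
            (trans (NP.m≥n⇒m⊔n≡m (NP.<⇒≤ (<ᵇ-true⇒< M x x>M))) (x≡N refl)) size′))
      ... | false = begin
            φ x
              ≡⟨ sumOver-cong (injWords N (x ∷ s) n) (λ w → winWeight-pass s x w (trans (exceedsAll≡listMax<ᵇ s x 1≤x) x>M)) ⟩
            sumOver (injWords N (x ∷ s) n) (winWeight 0 (x ∷ s))
              ≡⟨ sum-winWeight₀ n (x ∷ s) (ValidState-∷ valid 1≤x x≤N x∉s) size′ ⟩
            acceptWeight n (N ∸ (x ⊔ M))
              ≡⟨ cong (λ z → acceptWeight n (N ∸ z)) (NP.m≤n⇒m⊔n≡n (<ᵇ-false⇒≥ M x x>M)) ⟩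
            acceptWeight n (N ∸ M) ∎

    acceptSum : List ℕ → ℕ → ℚ
    acceptSum s n = sumOver (injWords N s n) (winWeight 0 s)

    sum-winWeight-split : ∀ j n s → sumOver (injWords N s (j ℕ.+ n)) (winWeight j s) ≡
      sumOver (injWords N s j) (λ p → θ ^ℚ lrmAux s p * acceptSum (reverse p ++ s) n)
    sum-winWeight-split zero n s = sym (trans (QP.+-identityʳ _) (QP.*-identityˡ _))
    sum-winWeight-split (suc j) n s = sum-injWords-suc-cong N s (j ℕ.+ n) j (winWeight (suc j) s) _ (λ x _ _ _ → begin
        sumOver (injWords N (x ∷ s) (j ℕ.+ n)) (λ w → winWeight (suc j) s (x ∷ w))
          ≡⟨ sumOver-cong (injWords N (x ∷ s) (j ℕ.+ n)) (winWeight-reject j s x) ⟩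
        sumOver (injWords N (x ∷ s) (j ℕ.+ n)) (λ w → recordFactor s x * winWeight j (x ∷ s) w)
          ≡⟨ sumOver-scale (injWords N (x ∷ s) (j ℕ.+ n)) (recordFactor s x) (winWeight j (x ∷ s)) ⟩
        recordFactor s x * sumOver (injWords N (x ∷ s) (j ℕ.+ n)) (winWeight j (x ∷ s))
          ≡⟨ cong (recordFactor s x *_) (sum-winWeight-split j n (x ∷ s)) ⟩
        recordFactor s x * sumOver (injWords N (x ∷ s) j) (λ p → θ ^ℚ lrmAux (x ∷ s) p * acceptSum (reverse p ++ x ∷ s) n)
          ≡⟨ sym (sumOver-scale (injWords N (x ∷ s) j) (recordFactor s x) _) ⟩
        sumOver (injWords N (x ∷ s) j) (λ p → recordFactor s x * (θ ^ℚ lrmAux (x ∷ s) p * acceptSum (reverse p ++ x ∷ s) n))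
          ≡⟨ sumOver-cong (injWords N (x ∷ s) j) (λ p → trans (sym (QP.*-assoc (recordFactor s x) _ _))
               (cong₂ _*_ (sym (^ℚ-lrmAux-∷ s x p)) (cong (λ t → acceptSum t n) (sym (reverse-∷-++ x p s))))) ⟩
        sumOver (injWords N (x ∷ s) j) (λ p → θ ^ℚ lrmAux s (x ∷ p) * acceptSum (reverse (x ∷ p) ++ s) n) ∎)
      where open ≡-Reasoning

    prefixTerm : (ℕ → ℕ → ℚ) → List ℕ → ℚ
    prefixTerm g p = θ ^ℚ lrmAux [] p * g (listMax p) (length p)

    prefixSum : ℕ → (ℕ → ℕ → ℚ) → ℚ
    prefixSum j g = sumOver (injWords N [] j) (prefixTerm g)

    -- One more entry after a prefix of length ℓ and maximum M is either a new record x > M (weight θ)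
    -- or one of the M ∸ ℓ unused values below M.
    extend : (ℕ → ℕ → ℚ) → ℕ → ℕ → ℚ
    extend g M ℓ = θ * sumBelow (N ∸ M) (λ i → g (suc (M ℕ.+ i)) (suc ℓ)) + ι (M ∸ ℓ) * g M (suc ℓ)

    sum-appendLetter : ∀ g p → ValidState N (reverse p ++ []) →
      sumOver (injWords N (reverse p ++ []) 1) (λ w → prefixTerm g (p ++ w)) ≡
      θ ^ℚ lrmAux [] p * extend g (listMax p) (length p)
    sum-appendLetter g p valid = begin
        sumOver (injWords N s 1) (λ w → prefixTerm g (p ++ w))
          ≡⟨ sum-injWords-suc N s 0 _ ⟩
        sumBelow N (λ i → if suc i ∈ᵇ s then 0ℚ else prefixTerm g (p ++ suc i ∷ []) + 0ℚ)
          ≡⟨ sumBelow-cong N (λ i _ → factor (suc i)) ⟩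
        sumBelow N (λ i → c * (if suc i ∈ᵇ s then 0ℚ else ψ (suc i)))
          ≡⟨ sumBelow-scale N c _ ⟩
        c * sumBelow N (λ i → if suc i ∈ᵇ s then 0ℚ else ψ (suc i))
          ≡⟨ cong (c *_) (sumBelow-unseen N s ψ (λ x → θ * g x (suc ℓ)) (g M (suc ℓ)) valid letter-shape) ⟩
        c * (sumBelow (N ∸ M) (λ i → θ * g (suc (M ℕ.+ i)) (suc ℓ)) + ι (M ∸ length s) * g M (suc ℓ))
          ≡⟨ cong₂ (λ z l → c * (z + ι (M ∸ l) * g M (suc ℓ))) (sumBelow-scale (N ∸ M) θ _) (length-reverse-++[] p) ⟩
        c * extend g M ℓ
          ≡⟨ cong (λ a → c * extend g a ℓ) (listMax-reverse-++[] p) ⟩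
        c * extend g (listMax p) (length p) ∎
      where
      open ≡-Reasoning
      s : List ℕ
      s = reverse p ++ []
      M : ℕ
      M = listMax s
      ℓ : ℕ
      ℓ = length p
      c : ℚ
      c = θ ^ℚ lrmAux [] p
      ψ : ℕ → ℚ
      ψ x = recordFactor s x * g (listMax p ⊔ x) (suc ℓ)
      prefixTerm-∷ʳ : ∀ x → prefixTerm g (p ++ x ∷ []) ≡ c * ψ x
      prefixTerm-∷ʳ x = begin
          θ ^ℚ lrmAux [] (p ++ x ∷ []) * g (listMax (p ++ x ∷ [])) (length (p ++ x ∷ []))
            ≡⟨ cong₃ (λ a b l → θ ^ℚ a * g b l) (lrmAux-++ [] p (x ∷ []))
                     (trans (listMax-++ p (x ∷ [])) (cong (listMax p ⊔_) (NP.⊔-identityʳ x)))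
                     (trans (LP.length-++ p) (NP.+-comm ℓ 1)) ⟩
          θ ^ℚ (lrmAux [] p ℕ.+ lrmAux s (x ∷ [])) * g (listMax p ⊔ x) (suc ℓ)
            ≡⟨ cong (_* g (listMax p ⊔ x) (suc ℓ)) (trans (^ℚ-+ θ (lrmAux [] p) _)
                 (cong (c *_) (trans (^ℚ-lrmAux-∷ s x []) (QP.*-identityʳ (recordFactor s x))))) ⟩
          c * recordFactor s x * g (listMax p ⊔ x) (suc ℓ)
            ≡⟨ QP.*-assoc c _ _ ⟩
          c * ψ x ∎
      factor : ∀ x → (if x ∈ᵇ s then 0ℚ else prefixTerm g (p ++ x ∷ []) + 0ℚ) ≡ c * (if x ∈ᵇ s then 0ℚ else ψ x)
      factor x with x ∈ᵇ s
      ... | true = sym (QP.*-zeroʳ c)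
      ... | false = trans (QP.+-identityʳ _) (prefixTerm-∷ʳ x)
      letter-shape : ∀ x → 1 ≤ x → x ≤ N → x ∈ᵇ s ≡ false → ψ x ≡ (if M <ᵇ x then θ * g x (suc ℓ) else g M (suc ℓ))
      letter-shape x 1≤x _ _ rewrite exceedsAll≡listMax<ᵇ s x 1≤x with M <ᵇ x in x>M
      ... | true = cong (λ z → θ * g z (suc ℓ))
                     (NP.m≤n⇒m⊔n≡n (NP.<⇒≤ (subst (_< x) (listMax-reverse-++[] p) (<ᵇ-true⇒< M x x>M))))
      ... | false = trans (QP.*-identityˡ _) (cong (λ z → g z (suc ℓ))
                     (trans (NP.m≥n⇒m⊔n≡m (subst (x ≤_) (listMax-reverse-++[] p) (<ᵇ-false⇒≥ M x x>M)))
                            (sym (listMax-reverse-++[] p))))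

    prefixSum-suc : ∀ j g → prefixSum (suc j) g ≡ prefixSum j (extend g)
    prefixSum-suc j g = begin
        sumOver (injWords N [] (suc j)) (prefixTerm g)
          ≡⟨ cong (λ t → sumOver (injWords N [] t) (prefixTerm g)) (NP.+-comm 1 j) ⟩
        sumOver (injWords N [] (j ℕ.+ 1)) (prefixTerm g)
          ≡⟨ sum-injWords-+ N j 1 [] (prefixTerm g) ⟩
        sumOver (injWords N [] j) (λ p → sumOver (injWords N (reverse p ++ []) 1) (λ w → prefixTerm g (p ++ w)))
          ≡⟨ sum-injWords-cong N j [] _ _ ValidState-[] (λ p valid _ → sum-appendLetter g p valid) ⟩
        prefixSum j (extend g) ∎
      where open ≡-Reasoning

    suffixWeight : ℕ → ℕ → ℚ
    suffixWeight M ℓ = acceptWeight (N ∸ ℓ) (N ∸ M)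

    sum-winWeight≡prefixSum : ∀ k → k ≤ N → sumOver (injWords N [] N) (winWeight k []) ≡ prefixSum k suffixWeight
    sum-winWeight≡prefixSum k k≤N = begin
        sumOver (injWords N [] N) (winWeight k [])
          ≡⟨ cong (λ t → sumOver (injWords N [] t) (winWeight k [])) (sym (NP.m+[n∸m]≡n k≤N)) ⟩
        sumOver (injWords N [] (k ℕ.+ (N ∸ k))) (winWeight k [])
          ≡⟨ sum-winWeight-split k (N ∸ k) [] ⟩
        sumOver (injWords N [] k) (λ p → θ ^ℚ lrmAux [] p * acceptSum (reverse p ++ []) (N ∸ k))
          ≡⟨ sum-injWords-cong N k [] _ _ ValidState-[] (λ p valid length≡k → cong (θ ^ℚ lrmAux [] p *_) (suffix p valid length≡k)) ⟩
        prefixSum k suffixWeight ∎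
      where
      open ≡-Reasoning
      suffix : ∀ p → ValidState N (reverse p ++ []) → length p ≡ k →
        acceptSum (reverse p ++ []) (N ∸ k) ≡ suffixWeight (listMax p) (length p)
      suffix p valid length≡k = trans
        (sum-winWeight₀ (N ∸ k) (reverse p ++ []) valid
          (trans (cong (N ∸ k ℕ.+_) (trans (length-reverse-++[] p) length≡k)) (NP.m∸n+n≡m k≤N)))
        (cong₂ (λ M ℓ → acceptWeight (N ∸ ℓ) (N ∸ M)) (listMax-reverse-++[] p) (sym length≡k))

    prefixSum-closed : ∀ j g → prefixSum j g ≡ rising θ j * sumBelow (suc N) (λ M → ι (subsetsWithMax j M) * g M j)
    prefixSum-closed zero g = trans (QP.+-identityʳ _) (cong (1ℚ *_) (sym (sumBelow-subsetsWithMax₀ N (λ M → g M 0))))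
    prefixSum-closed (suc j) g = begin
        prefixSum (suc j) g
          ≡⟨ trans (prefixSum-suc j g) (prefixSum-closed j (extend g)) ⟩
        rising θ j * sumBelow (suc N) (λ M → a M * extend g M j)
          ≡⟨ cong (rising θ j *_) (trans (sumBelow-cong (suc N) (λ M _ → distribute M)) (sumBelow-distrib-+ (suc N) _ _)) ⟩
        rising θ j * (sumBelow (suc N) (λ M → θ * (a M * above M)) + sumBelow (suc N) (λ M → ι (M ∸ j) * a M * h M))
          ≡⟨ cong (λ z → rising θ j * (z + sumBelow (suc N) (λ M → ι (M ∸ j) * a M * h M))) new-records ⟩
        rising θ j * (θ * S + sumBelow (suc N) (λ M → ι (M ∸ j) * a M * h M))
          ≡⟨ cong (λ z → rising θ j * (θ * S + z)) old-values ⟩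
        rising θ j * (θ * S + ι j * S)
          ≡⟨ solve 4 (λ r t i s → r :* (t :* s :+ i :* s) := r :* (t :+ i) :* s) refl (rising θ j) θ (ι j) S ⟩
        rising θ j * (θ + ι j) * S
          ≡⟨ cong (_* S) (sym (rising-suc θ j)) ⟩
        rising θ (suc j) * S ∎
      where
      open ≡-Reasoning
      a : ℕ → ℚ
      a M = ι (subsetsWithMax j M)
      h : ℕ → ℚ
      h x = g x (suc j)
      above : ℕ → ℚ
      above M = sumBelow (N ∸ M) (λ i → h (suc (M ℕ.+ i)))
      S : ℚ
      S = sumBelow (suc N) (λ x → ι (subsetsWithMax (suc j) x) * h x)
      distribute : ∀ M → a M * extend g M j ≡ θ * (a M * above M) + ι (M ∸ j) * a M * h M
      distribute M = solve 5 (λ a t u c h → a :* (t :* u :+ c :* h) := t :* (a :* u) :+ c :* a :* h)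
                             refl (a M) θ (above M) (ι (M ∸ j)) (h M)
      new-records : sumBelow (suc N) (λ M → θ * (a M * above M)) ≡ θ * S
      new-records = trans (sumBelow-scale (suc N) θ _) (cong (θ *_) (trans (sumBelow-swap (suc N) a h)
        (sumBelow-cong (suc N) (λ x _ → cong (_* h x) (sym (ι-sumBelowℕ x (subsetsWithMax j)))))))
      old-values : sumBelow (suc N) (λ M → ι (M ∸ j) * a M * h M) ≡ ι j * S
      old-values = trans (sumBelow-cong (suc N) (λ M _ → trans (cong (_* h M) (absorb M)) (QP.*-assoc (ι j) _ _)))
                         (sumBelow-scale (suc N) (ι j) _)
        where
        absorb : ∀ M → ι (M ∸ j) * a M ≡ ι j * ι (subsetsWithMax (suc j) M)
        absorb M = trans (sym (ι-homo-* (M ∸ j) (subsetsWithMax j M)))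
                         (trans (cong ι (subsetsWithMax-absorb j M)) (ι-homo-* j (subsetsWithMax (suc j) M)))

    sumBelow-acceptWeight : ∀ n d → sumBelow (suc d) (λ i → acceptWeight n (d ∸ i)) ≡ θ * ι (n !) * harmonic d
    sumBelow-acceptWeight n zero = trans (QP.+-identityʳ 0ℚ) (sym (QP.*-zeroʳ (θ * ι (n !))))
    sumBelow-acceptWeight n (suc d) = trans (sumBelow-head (suc d) _) (trans (cong (acceptWeight n (suc d) +_) (sumBelow-acceptWeight n d))
      (solve 3 (λ x v h → x :* v :+ x :* h := x :* (h :+ v)) refl (θ * ι (n !)) (1/suc d) (harmonic d)))

    X : ℕ → ℚ
    X k = θ * ι ((N ∸ suc k) !)

    Δsuffix : ℕ → ℕ → ℚ
    Δsuffix M k = extend suffixWeight M k - suffixWeight M k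

    Δsuffix-below : ∀ k M → k ≤ M → M < N → Δsuffix M k ≡ X k * (θ * harmonic (N ∸ suc M) - 1ℚ)
    Δsuffix-below k M k≤M M<N = begin
        θ * sumBelow (N ∸ M) (λ i → acceptWeight n (N ∸ suc (M ℕ.+ i))) + ι (M ∸ k) * acceptWeight n (N ∸ M) - acceptWeight (N ∸ k) (N ∸ M)
          ≡⟨ cong₃ (λ x y z → θ * x + ι (M ∸ k) * acceptWeight n y - acceptWeight z y)
               (trans (cong (λ z → sumBelow z (λ i → acceptWeight n (N ∸ suc (M ℕ.+ i)))) (m<n⇒n∸m≡1+[n∸1+m] M<N))
                      (sumBelow-cong (suc d) (λ i _ → cong (acceptWeight n) (sym (NP.∸-+-assoc N (suc M) i)))))
               (m<n⇒n∸m≡1+[n∸1+m] M<N) (m<n⇒n∸m≡1+[n∸1+m] k<N) ⟩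
        θ * sumBelow (suc d) (λ i → acceptWeight n (d ∸ i)) + ι (M ∸ k) * acceptWeight n (suc d) - acceptWeight (suc n) (suc d)
          ≡⟨ cong (λ z → θ * z + ι (M ∸ k) * acceptWeight n (suc d) - acceptWeight (suc n) (suc d)) (sumBelow-acceptWeight n d) ⟩
        θ * (θ * ι (n !) * harmonic d) + ι (M ∸ k) * (θ * ι (n !) * 1/suc d) - θ * ι (suc n !) * 1/suc d
          ≡⟨ cong (λ z → θ * (θ * ι (n !) * harmonic d) + ι (M ∸ k) * (θ * ι (n !) * 1/suc d) - θ * z * 1/suc d)
               (trans (ι-homo-* (suc n) (n !)) (cong (_* ι (n !)) (sym (trans (sym (ι-homo-+ (M ∸ k) (suc d))) (cong ι unseen))))) ⟩
        θ * (θ * ι (n !) * harmonic d) + ι (M ∸ k) * (θ * ι (n !) * 1/suc d) - θ * ((ι (M ∸ k) + ι (suc d)) * ι (n !)) * 1/suc d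
          ≡⟨ solve 6 (λ t f h p q v → t :* (t :* f :* h) :+ p :* (t :* f :* v) :- t :* ((p :+ q) :* f) :* v := t :* f :* (t :* h :- q :* v))
                     refl θ (ι (n !)) (harmonic d) (ι (M ∸ k)) (ι (suc d)) (1/suc d) ⟩
        θ * ι (n !) * (θ * harmonic d - ι (suc d) * 1/suc d)
          ≡⟨ cong (λ z → θ * ι (n !) * (θ * harmonic d - z)) (ι-suc*1/suc≡1 d) ⟩
        θ * ι (n !) * (θ * harmonic d - 1ℚ) ∎
      where
      open ≡-Reasoning
      n : ℕ
      n = N ∸ suc k
      d : ℕ
      d = N ∸ suc M
      k<N : k < N
      k<N = NP.≤-<-trans k≤M M<N
      unseen : M ∸ k ℕ.+ suc d ≡ suc n
      unseen = begin
        M ∸ k ℕ.+ suc d   ≡⟨ cong (M ∸ k ℕ.+_) (sym (m<n⇒n∸m≡1+[n∸1+m] M<N)) ⟩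
        M ∸ k ℕ.+ (N ∸ M) ≡⟨ NP.+-comm (M ∸ k) (N ∸ M) ⟩
        N ∸ M ℕ.+ (M ∸ k) ≡⟨ sym (NP.+-∸-assoc (N ∸ M) k≤M) ⟩
        N ∸ M ℕ.+ M ∸ k   ≡⟨ cong (_∸ k) (NP.m∸n+n≡m (NP.<⇒≤ M<N)) ⟩
        N ∸ k             ≡⟨ m<n⇒n∸m≡1+[n∸1+m] k<N ⟩
        suc n ∎

    Δsuffix-top : ∀ k → Δsuffix N k ≡ 0ℚ
    Δsuffix-top k rewrite NP.n∸n≡0 N = cong₂ (λ x y → x + y - 0ℚ) (QP.*-zeroʳ θ) (QP.*-zeroʳ (ι (N ∸ k)))

    subsetsWithMax*Δsuffix : ∀ k M → M < N → ι (subsetsWithMax k M) * Δsuffix M k ≡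
      ι (subsetsWithMax k M) * (X k * (θ * harmonic (N ∸ suc M) - 1ℚ))
    subsetsWithMax*Δsuffix k M M<N with k ℕ.≤? M
    ... | yes k≤M = cong (ι (subsetsWithMax k M) *_) (Δsuffix-below k M k≤M M<N)
    ... | no k≰M rewrite subsetsWithMax-< k M (NP.≰⇒> k≰M) =
      trans (QP.*-zeroˡ (Δsuffix M k)) (sym (QP.*-zeroˡ (X k * (θ * harmonic (N ∸ suc M) - 1ℚ))))

    ΔprefixSum-suffixWeight : ∀ k m → N ≡ suc m → prefixSum (suc k) suffixWeight - prefixSum k suffixWeight ≡
      rising θ k * (X k * (θ * weightedHarmonic k m - ι (subsetsWithMax (suc k) N)))
    ΔprefixSum-suffixWeight k m N≡1+m = begin
        prefixSum (suc k) suffixWeight - prefixSum k suffixWeight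
          ≡⟨ cong₂ _-_ (trans (prefixSum-suc k suffixWeight) (prefixSum-closed k (extend suffixWeight))) (prefixSum-closed k suffixWeight) ⟩
        rising θ k * sumBelow (suc N) (λ M → E M * extend suffixWeight M k) - rising θ k * sumBelow (suc N) (λ M → E M * suffixWeight M k)
          ≡⟨ trans (sym (*-distribˡ-- (rising θ k) _ _)) (cong (rising θ k *_) (sym (sumBelow-distrib-- (suc N) _ _))) ⟩
        rising θ k * sumBelow (suc N) (λ M → E M * extend suffixWeight M k - E M * suffixWeight M k)
          ≡⟨ cong (rising θ k *_) (sumBelow-cong (suc N) (λ M _ → sym (*-distribˡ-- (E M) _ _))) ⟩
        rising θ k * (sumBelow N (λ M → E M * Δsuffix M k) + E N * Δsuffix N k)
          ≡⟨ cong (λ z → rising θ k * (sumBelow N (λ M → E M * Δsuffix M k) + z))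
                  (trans (cong (E N *_) (Δsuffix-top k)) (QP.*-zeroʳ (E N))) ⟩
        rising θ k * (sumBelow N (λ M → E M * Δsuffix M k) + 0ℚ)
          ≡⟨ cong (rising θ k *_) (trans (QP.+-identityʳ _) (sumBelow-cong N (λ M M<N → subsetsWithMax*Δsuffix k M M<N))) ⟩
        rising θ k * sumBelow N (λ M → E M * (X k * (θ * harmonic (N ∸ suc M) - 1ℚ)))
          ≡⟨ cong (rising θ k *_) (sumBelow-cong N (λ M _ →
               solve 4 (λ a x t h → a :* (x :* (t :* h :- con 1ℚ)) := x :* t :* (a :* h) :- x :* a)
                       refl (E M) (X k) θ (harmonic (N ∸ suc M)))) ⟩
        rising θ k * sumBelow N (λ M → X k * θ * (E M * harmonic (N ∸ suc M)) - X k * E M)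
          ≡⟨ cong (rising θ k *_) (trans (sumBelow-distrib-- N _ _) (cong₂ _-_ (sumBelow-scale N (X k * θ) _) (sumBelow-scale N (X k) _))) ⟩
        rising θ k * (X k * θ * sumBelow N (λ M → E M * harmonic (N ∸ suc M)) - X k * sumBelow N E)
          ≡⟨ cong₂ (λ u v → rising θ k * (X k * θ * u - X k * v))
                   (weightedHarmonic-unfold k N m N≡1+m) (sym (ι-sumBelowℕ N (subsetsWithMax k))) ⟩
        rising θ k * (X k * θ * weightedHarmonic k m - X k * ι (subsetsWithMax (suc k) N))
          ≡⟨ cong (rising θ k *_) (solve 4 (λ x t b e → x :* t :* b :- x :* e := x :* (t :* b :- e))
                                           refl (X k) θ (weightedHarmonic k m) (ι (subsetsWithMax (suc k) N))) ⟩
        rising θ k * (X k * (θ * weightedHarmonic k m - ι (subsetsWithMax (suc k) N))) ∎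
      where
      open ≡-Reasoning
      E : ℕ → ℚ
      E M = ι (subsetsWithMax k M)

  -- The closed form of ΔW and its roots

  winnableᵇ≡hits : ∀ N k π → winnableᵇ N k π ≡ hits N (select k π)
  winnableᵇ≡hits N k π with select k π
  ... | just x = refl
  ... | nothing = refl

  W≡sum-winWeight : ∀ N k θ → W N k θ ≡ sumOver (injWords N [] N) (Weights.winWeight N θ k [])
  W≡sum-winWeight N k θ = begin
      W N k θ
        ≡⟨ sumOver-filterᵇ (winnableᵇ N k) (perms N) (θ ^ℚ_ ∘ lrm) ⟩
      sumOver (perms N) (λ π → if winnableᵇ N k π then θ ^ℚ lrm π else 0ℚ)
        ≡⟨ sumOver-cong (perms N) (λ π → cong (λ b → if b then θ ^ℚ lrm π else 0ℚ) (winnableᵇ≡hits N k π)) ⟩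
      sumOver (perms N) (Weights.winWeight N θ k [])
        ≡⟨ cong (λ πs → sumOver πs (Weights.winWeight N θ k [])) (perms≡injWords N) ⟩
      sumOver (injWords N [] N) (Weights.winWeight N θ k []) ∎
    where open ≡-Reasoning

  c₁≡!*subsetsWithMax : ∀ m k → k ≤ m → c₁ (suc m) k ≡ (m ∸ k) ! ℕ.* subsetsWithMax (suc k) (suc m)
  c₁≡!*subsetsWithMax m k k≤m = trans (product-range≡!*subsetsWithMax k (m ∸ k))
    (cong (λ z → (m ∸ k) ! ℕ.* subsetsWithMax (suc k) (suc z)) (NP.m+[n∸m]≡n k≤m))

  H≡harmonic-harmonic : ∀ m k → k ≤ suc m → H (suc (suc m)) k ≡ harmonic (suc m) - harmonic k
  H≡harmonic-harmonic m k k≤m = trans (sumOver-applyUpTo (k ℕ.+_) (suc m ∸ k) 1/suc)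
    (trans (sumBelow-1/suc k (suc m ∸ k)) (cong (λ z → harmonic z - harmonic k) (NP.m+[n∸m]≡n k≤m)))

  ΔW-closedForm : ∀ m k → k ≤ suc m → ∀ θ →
    ΔW (suc (suc m)) k θ ≡ ι (c₁ (suc (suc m)) k) * ((H (suc (suc m)) k * θ - 1ℚ) * (θ * rising θ k))
  ΔW-closedForm m k k≤1+m θ = begin
      W N (suc k) θ - W N k θ
        ≡⟨ cong₂ _-_ (trans (W≡sum-winWeight N (suc k) θ) (sum-winWeight≡prefixSum (suc k) (s≤s k≤1+m)))
                     (trans (W≡sum-winWeight N k θ) (sum-winWeight≡prefixSum k (NP.m≤n⇒m≤1+n k≤1+m))) ⟩
      prefixSum (suc k) suffixWeight - prefixSum k suffixWeight
        ≡⟨ ΔprefixSum-suffixWeight k (suc m) refl ⟩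
      rising θ k * (θ * ι (d !) * (θ * weightedHarmonic k (suc m) - ι E))
        ≡⟨ cong (λ z → rising θ k * (θ * ι (d !) * (θ * z - ι E))) (weightedHarmonic-closed k (suc m)) ⟩
      rising θ k * (θ * ι (d !) * (θ * (ι E * (harmonic (suc m) - harmonic k)) - ι E))
        ≡⟨ solve 6 (λ r t f e h h′ → r :* (t :* f :* (t :* (e :* (h :- h′)) :- e)) := f :* e :* (((h :- h′) :* t :- con 1ℚ) :* (t :* r)))
                 refl (rising θ k) θ (ι (d !)) (ι E) (harmonic (suc m)) (harmonic k) ⟩
      ι (d !) * ι E * (((harmonic (suc m) - harmonic k) * θ - 1ℚ) * (θ * rising θ k))
        ≡⟨ cong₂ (λ c h → c * ((h * θ - 1ℚ) * (θ * rising θ k)))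
                 (trans (sym (ι-homo-* (d !) E)) (cong ι (sym (c₁≡!*subsetsWithMax (suc m) k k≤1+m))))
                 (sym (H≡harmonic-harmonic m k k≤1+m)) ⟩
      ι (c₁ N k) * ((H N k * θ - 1ℚ) * (θ * rising θ k)) ∎
    where
    open ≡-Reasoning
    N : ℕ
    N = suc (suc m)
    d : ℕ
    d = suc m ∸ k
    E : ℕ
    E = subsetsWithMax (suc k) N
    open Weights N θ

  Πℚ-θ-negatives≡rising : ∀ θ k → Πℚ (map (λ r → θ - r) (applyUpTo (λ i → - ι i) k)) ≡ rising θ k
  Πℚ-θ-negatives≡rising θ k = cong Πℚ (trans (LP.map-applyUpTo (λ i → - ι i) (λ r → θ - r) k)
    (applyUpTo-cong _ _ k (λ i → solve 2 (λ t x → t :- (:- x) := t :+ x) refl θ (ι i))))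

  roots-linear*rising : ∀ (f : ℚ → ℚ) a h k → Q.Positive a → Q.Positive h →
    (∀ θ → f θ ≡ a * ((h * θ - 1ℚ) * (θ * rising θ k))) →
    ∃[ c ] ∃[ rs ] (c ≢ 0ℚ)
      × (∀ θ → f θ ≡ c * Πℚ (map (λ r → θ - r) rs))
      × (∃[ r ] (r ∈ rs × r * h ≡ 1ℚ))
      × (∀ r → r ∈ rs → 0ℚ Q.< r → r * h ≡ 1ℚ)
  roots-linear*rising f a h k a>0 h>0 f≡ =
    a * h , 1/h ∷ 0ℚ ∷ negatives , c≢0 , factorisation , (1/h , here refl , 1/h*h≡1) , positive-root
    where
    instance
      h≢0 : Q.NonZero h
      h≢0 = QP.pos⇒nonZero h {{h>0}}
    1/h : ℚ
    1/h = Q.1/ h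
    1/h*h≡1 : 1/h * h ≡ 1ℚ
    1/h*h≡1 = QP.*-inverseˡ h
    negatives : List ℚ
    negatives = applyUpTo (λ i → - ι i) k
    c≢0 : a * h ≢ 0ℚ
    c≢0 ah≡0 = QP.<⇒≢ (QP.positive⁻¹ (a * h) {{QP.pos*pos⇒pos a {{a>0}} h {{h>0}}}}) (sym ah≡0)
    factorisation : ∀ θ → f θ ≡ a * h * Πℚ (map (λ r → θ - r) (1/h ∷ 0ℚ ∷ negatives))
    factorisation θ = begin
        f θ
          ≡⟨ f≡ θ ⟩
        a * ((h * θ - 1ℚ) * (θ * rising θ k))
          ≡⟨ cong (λ z → a * ((h * θ - z) * (θ * rising θ k))) (sym (QP.*-inverseʳ h)) ⟩
        a * ((h * θ - h * 1/h) * (θ * rising θ k))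
          ≡⟨ solve 5 (λ a h t r R → a :* ((h :* t :- h :* r) :* (t :* R)) := a :* h :* ((t :- r) :* ((t :- con 0ℚ) :* R)))
                     refl a h θ 1/h (rising θ k) ⟩
        a * h * ((θ - 1/h) * ((θ - 0ℚ) * rising θ k))
          ≡⟨ cong (λ z → a * h * ((θ - 1/h) * ((θ - 0ℚ) * z))) (sym (Πℚ-θ-negatives≡rising θ k)) ⟩
        a * h * Πℚ (map (λ r → θ - r) (1/h ∷ 0ℚ ∷ negatives)) ∎
      where open ≡-Reasoning
    positive-root : ∀ r → r ∈ 1/h ∷ 0ℚ ∷ negatives → 0ℚ Q.< r → r * h ≡ 1ℚ
    positive-root r (here refl) _ = 1/h*h≡1
    positive-root r (there (here refl)) 0<0 = ⊥-elim (QP.<-irrefl refl 0<0)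
    positive-root r (there (there r∈negatives)) 0<r with i , _ , refl ← LMP.∈-applyUpTo⁻ (λ i → - ι i) r∈negatives =
      ⊥-elim (QP.<-irrefl refl (QP.<-≤-trans 0<r (QP.neg-antimono-≤ (QP.nonNegative⁻¹ (ι i) {{QP.normalize-nonNeg i 1}}))))

  1/suc-positive : ∀ j → Q.Positive (1/suc j)
  1/suc-positive j = QP.normalize-pos 1 (suc j)

  Σℚ-1/suc-nonNegative : ∀ js → Q.NonNegative (Σℚ (map 1/suc js))
  Σℚ-1/suc-nonNegative [] = QP.normalize-nonNeg 0 1
  Σℚ-1/suc-nonNegative (j ∷ js) = QP.nonNeg+nonNeg⇒nonNeg (1/suc j) {{QP.pos⇒nonNeg (1/suc j) {{1/suc-positive j}}}}
    (Σℚ (map 1/suc js)) {{Σℚ-1/suc-nonNegative js}}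

  H-positive : ∀ m k → k ≤ m → Q.Positive (H (suc (suc m)) k)
  H-positive m k k≤m = subst (λ t → Q.Positive (Σℚ (map 1/suc (applyUpTo (k ℕ.+_) t)))) (sym (NP.+-∸-assoc 1 k≤m))
    (QP.pos+nonNeg⇒pos (1/suc (k ℕ.+ 0)) {{1/suc-positive (k ℕ.+ 0)}}
      _ {{Σℚ-1/suc-nonNegative (applyUpTo (λ t → k ℕ.+ suc t) (m ∸ k))}})

  product-applyUpTo-nonZero : ∀ (f : ℕ → ℕ) d → (∀ t → ℕ.NonZero (f t)) → ℕ.NonZero (foldr ℕ._*_ 1 (applyUpTo f d))
  product-applyUpTo-nonZero f zero f≢0 = _
  product-applyUpTo-nonZero f (suc d) f≢0 =
    NP.m*n≢0 (f 0) _ {{f≢0 0}} {{product-applyUpTo-nonZero (f ∘ suc) d (f≢0 ∘ suc)}}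

  c₁-positive : ∀ N k → Q.Positive (ι (c₁ N k))
  c₁-positive N k =
    QP.normalize-pos (c₁ N k) 1 {{_}} {{product-applyUpTo-nonZero (suc k ℕ.+_) (suc (N ∸ 1) ∸ suc k) (λ _ → _)}}

open import Defs
open import Data.Nat using (ℕ; suc; _≤_; _∸_)
open import Data.Rational using (ℚ; 0ℚ; 1ℚ; _*_; _-_; _<_)
open import Data.List using (List; map)
open import Data.List.Membership.Propositional using (_∈_)
open import Data.Product using (_×_; ∃; ∃-syntax)
open import Relation.Binary.PropositionalEquality using (_≡_; _≢_)
open import Data.Nat using (z≤n; s≤s)
import Data.Nat.Properties as NP
open import Data.Product using (_,_)
open WinnablePermutations

theorem4p5 : ∀ (N k : ℕ) → 2 ≤ N → k ≤ N ∸ 2 →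
  (∀ (θ : ℚ) → ΔW N k θ ≡ ι (c₁ N k) * ((H N k * θ - 1ℚ) * (θ * rising θ k)))
  × (∃[ c ] ∃[ rs ] (c ≢ 0ℚ)
      × (∀ (θ : ℚ) → ΔW N k θ ≡ c * Πℚ (map (λ r → θ - r) rs))
      × (∃[ r ] (r ∈ rs × r * H N k ≡ 1ℚ))
      × (∀ r → r ∈ rs → 0ℚ < r → r * H N k ≡ 1ℚ))
theorem4p5 (suc (suc m)) k (s≤s (s≤s z≤n)) k≤m =
  closedForm , roots-linear*rising (ΔW N k) (ι (c₁ N k)) (H N k) k (c₁-positive N k) (H-positive m k k≤m) closedForm
  where
  N : ℕ
  N = suc (suc m)
  closedForm : ∀ θ → ΔW N k θ ≡ ι (c₁ N k) * ((H N k * θ - 1ℚ) * (θ * rising θ k))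
  closedForm = ΔW-closedForm m k (NP.m≤n⇒m≤1+n k≤m)
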